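{- Let $G$ be a $K_4$-minor-free graph and let $x,y,z$ be distinct vertices of $G$. If $\{x,y,z\}$ is feasible, then $G$ is $(2,2,2)$-AT extendable with respect to $(x,y,z)$.
   Context: All graphs are simple. For an orientation $D$ of $G$, an Eulerian sub-digraph is a spanning sub-digraph $F$ of $D$ with $d_F^+(v)=d_F^-(v)$ for all $v$; $\mathrm{diff}(D)$ is the number of Eulerian sub-digraphs with an even number of arcs minus the number with an odd number of arcs; $D$ is an AT-orientation if $\mathrm{diff}(D)\ne0$. For $f:V(G)\to\mathbb{N}$, $G$ is $f$-AT if it has an AT-orientation $D$ with $d_D^+(v)\le f(v)-1$ for all $v$. $G$ is $(2,2,2)$-AT extendable with respect to $(x,y,z)$ if $G$ is $f$-AT where $f(x)=f(y)=f(z)=2$ and $f(v)=3$ otherwise. The chain of diamonds $D_n$ ($n\in\mathbb{N}$) has vertex set $\{u_i,v_i,w_i:i\in[n]\}\cup\{u_0\}$ and edges $\{u_{i-1}v_i,u_{i-1}w_i,v_iw_i,v_iu_i,w_iu_i:i\in[n]\}$; $U(D_n)=\{u_0,\dots,u_n\}$. A set $X$ of vertices of $G$ is connected by a chain of diamonds if there are $n\in\mathbb{N}$ and a homomorphism $\varphi:D_n\to G$ with $X\subseteq\varphi(U(D_n))$. A set $X$ of three distinct vertices of $G$ is feasible if $X$ is not connected by a chain of diamonds and there is a proper $3$-coloring $\phi$ of $G$ with $|\phi(X)|\le 2$. -}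

module Defs where

open import Data.Nat as ℕ using (ℕ; zero; suc; _≤_; _∸_; _≡ᵇ_)
open import Data.Nat.Base using (_%_)
open import Data.Bool using (Bool; true; false; if_then_else_; _∧_)
open import Data.Fin using (Fin; zero; suc; toℕ; inject₁) renaming (_≟_ to _≟F_)
open import Data.List using (List; []; _∷_; _++_; map; concatMap; filterᵇ; length; foldr)
open import Data.List using () renaming (allFin to allFinL)
open import Data.Maybe using (Maybe; just)
open import Data.Product using (Σ; ∃; _×_; _,_; proj₁; proj₂)
open import Data.Sum using (_⊎_)
open import Data.Integer as ℤ using (ℤ; +_; -_)
open import Relation.Nullary using (¬_; does)
open import Relation.Binary.PropositionalEquality using (_≡_; _≢_)

record Graph : Set where
  field
    n      : ℕ
    adj    : Fin n → Fin n → Bool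
    sym    : ∀ u v → adj u v ≡ adj v u
    irrefl : ∀ v → adj v v ≡ false
open Graph public

V : Graph → Set
V G = Fin (n G)

Adj : (G : Graph) → V G → V G → Set
Adj G u v = adj G u v ≡ true

record Orientation (G : Graph) : Set where
  field
    arc      : V G → V G → Bool
    arc⇒adj  : ∀ u v → arc u v ≡ true → Adj G u v
    adj⇒one  : ∀ u v → Adj G u v →
               (arc u v ≡ true × arc v u ≡ false) ⊎ (arc u v ≡ false × arc v u ≡ true)
open Orientation public

allPairs : (k : ℕ) → List (Fin k × Fin k)
allPairs k = concatMap (λ u → map (λ v → (u , v)) (allFinL k)) (allFinL k)

arcs : {G : Graph} → Orientation G → List (V G × V G)
arcs {G} D = filterᵇ (λ e → arc D (proj₁ e) (proj₂ e)) (allPairs (n G))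

-- all sub-lists (= all arc subsets, i.e. all spanning sub-digraphs)
subsets : {A : Set} → List A → List (List A)
subsets []       = [] ∷ []
subsets (a ∷ as) = subsets as ++ map (a ∷_) (subsets as)

eqF : {k : ℕ} → Fin k → Fin k → Bool
eqF u v = does (u ≟F v)

outdegIn : {k : ℕ} → List (Fin k × Fin k) → Fin k → ℕ
outdegIn F v = length (filterᵇ (λ e → eqF (proj₁ e) v) F)

indegIn : {k : ℕ} → List (Fin k × Fin k) → Fin k → ℕ
indegIn F v = length (filterᵇ (λ e → eqF (proj₂ e) v) F)

allB : {A : Set} → (A → Bool) → List A → Bool
allB p = foldr (λ a b → p a ∧ b) true

isEulerian : {k : ℕ} → List (Fin k × Fin k) → Bool
isEulerian {k} F = allB (λ v → outdegIn F v ≡ᵇ indegIn F v) (allFinL k)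

diff : {G : Graph} → Orientation G → ℤ
diff D = foldr ℤ._+_ (+ 0) (map contrib (subsets (arcs D)))
  where
  contrib : _ → ℤ
  contrib F = if isEulerian F
                then (if length F % 2 ≡ᵇ 0 then + 1 else - (+ 1))
                else + 0

IsAT : {G : Graph} → Orientation G → Set
IsAT D = diff D ≢ + 0

outdeg : {G : Graph} → Orientation G → V G → ℕ
outdeg {G} D v = length (filterᵇ (λ w → arc D v w) (allFinL (n G)))

IsfAT : (G : Graph) → (V G → ℕ) → Set
IsfAT G f = Σ (Orientation G) λ D → IsAT D × (∀ v → outdeg D v ≤ f v ∸ 1)

f222 : (G : Graph) → V G → V G → V G → V G → ℕ
f222 G x y z v = if eqF v x then 2 else if eqF v y then 2 else if eqF v z then 2 else 3

AT222Extendable : (G : Graph) → V G → V G → V G → Set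
AT222Extendable G x y z = IsfAT G (f222 G x y z)

data WalkIn (G : Graph) (P : V G → Set) : V G → V G → Set where
  here : ∀ {u} → WalkIn G P u u
  step : ∀ {u w v} → Adj G u w → P w → WalkIn G P w v → WalkIn G P u v

HasK4Minor : Graph → Set
HasK4Minor G =
  Σ (V G → Maybe (Fin 4)) λ b →
    (∀ i → ∃ λ v → b v ≡ just i)
  × (∀ i u v → b u ≡ just i → b v ≡ just i → WalkIn G (λ w → b w ≡ just i) u v)
  × (∀ i j → i ≢ j → ∃ λ u → ∃ λ v → b u ≡ just i × b v ≡ just j × Adj G u v)

K4MinorFree : Graph → Set
K4MinorFree G = ¬ HasK4Minor G

-- Chains of diamonds
-- A homomorphism φ : D_m → G given by images uφ i (i = 0..m) of u_i and
-- vφ i, wφ i (i = 1..m, indexed by Fin m) of v_{i+1}, w_{i+1}.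

record DiamondHom (G : Graph) (m : ℕ) : Set where
  field
    uφ : Fin (suc m) → V G
    vφ : Fin m → V G
    wφ : Fin m → V G
    e₁ : ∀ i → Adj G (uφ (inject₁ i)) (vφ i)
    e₂ : ∀ i → Adj G (uφ (inject₁ i)) (wφ i)
    e₃ : ∀ i → Adj G (vφ i) (wφ i)
    e₄ : ∀ i → Adj G (vφ i) (uφ (suc i))
    e₅ : ∀ i → Adj G (wφ i) (uφ (suc i))
open DiamondHom public

InUImage : {G : Graph} {m : ℕ} → DiamondHom G m → V G → Set
InUImage φ a = ∃ λ i → uφ φ i ≡ a

ConnectedByDiamonds : (G : Graph) → V G → V G → V G → Set
ConnectedByDiamonds G x y z =
  Σ ℕ λ m → Σ (DiamondHom G m) λ φ → InUImage φ x × InUImage φ y × InUImage φ z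

Proper3Coloring : Graph → Set
Proper3Coloring G = Σ (V G → Fin 3) λ c → ∀ u v → Adj G u v → c u ≢ c v

Feasible : (G : Graph) → V G → V G → V G → Set
Feasible G x y z =
  ¬ ConnectedByDiamonds G x y z
  × (Σ (V G → Fin 3) λ c → (∀ u v → Adj G u v → c u ≢ c v)
        × (c x ≡ c y ⊎ c y ≡ c z ⊎ c x ≡ c z))

-- The number of Eulerian sub-digraphs of D has the same parity as the number of orientations with the out-degrees
-- of D, which is a coefficient of P_G = ∏_{uv ∈ E} (x_u + x_v) over 𝔽₂.  Hence it suffices that x y z P_G ≠ 0 in
-- 𝔽₂[V] / (v³ : v ∈ V).  In this ring u P_G = (a + b) P_G for every triangle uab, so vertices joined by a chain of
-- diamonds act alike on P_G, and a triangle satisfies a² + bc = 0.  By induction on the set of non-isolated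
-- vertices, x y z P_G ≠ 0 unless x, y, z are diamond-connected to a single vertex or to the three vertices of a
-- triangle; feasibility excludes both.  The induction removes a vertex of degree at most two and reads off one
-- coefficient.  The critical case is a removed vertex in {x, y, z} whose neighbours p, q span an edge lying in no
-- other triangle; one then also removes the next vertex p, with neighbours q and p′ ≁ q, and has the choice between
-- two coefficients, which replace x by p′ or by q².  If p′ fails then q² works, because q² p′² P_H ≠ 0
-- whenever H + qp′ is K₄-minor-free.
module Submission where

open import Defs using
  ( Graph; V; Adj; Orientation; arcs; allPairs; subsets; eqF; outdegIn; indegIn; allB; isEulerian; diff; IsAT
  ; outdeg; f222; AT222Extendable; WalkIn; K4MinorFree; DiamondHom; InUImage; ConnectedByDiamonds; Feasible )
open import Level using (0ℓ)
open import Algebra.Bundles using (CommutativeSemiring; CommutativeRing)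
open import Algebra.Solver.Ring.AlmostCommutativeRing using (fromCommutativeSemiring; _-Raw-AlmostCommutative⟶_)
import Data.Bool as Bool
open import Data.Bool using (Bool; true; false; if_then_else_; _xor_)
open import Data.Bool.Properties using (xor-∧-commutativeRing; xor-assoc; xor-identityʳ; T?; T-≡)
open import Data.Fin as Fin using (Fin; zero; suc; _≟_)
open import Data.Fin.Properties as Finₚ using (any?; all?)
open import Data.Fin.Subset using (Subset; _⊂_) renaming (_∈_ to _∈ₛ_)
open import Data.Fin.Subset.Induction using (⊂-wellFounded)
open import Data.Integer as ℤ using (ℤ; +_; -[1+_])
import Data.Integer.Solver as ℤSolver
open import Data.List using (List; []; _∷_; _++_; map; concatMap; foldr; filter; filterᵇ; allFin; cartesianProduct)
open import Data.List.Properties using (filter-accept; filter-reject; map-++; map-∘; length-map)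
open import Data.List.Membership.Propositional using (_∈_)
open import Data.List.Membership.Propositional.Properties
  using (∈-filter⁺; ∈-filter⁻; ∈-map⁺; ∈-map⁻; ∈-allFin; ∈-cartesianProduct⁺)
open import Data.List.Membership.Propositional.Properties.WithK using (unique∧set⇒bag)
open import Data.List.Relation.Binary.BagAndSetEquality using (∼bag⇒↭)
open import Data.List.Relation.Binary.Permutation.Propositional as ↭ using (_↭_)
open import Data.List.Relation.Binary.Permutation.Propositional.Properties using (↭-length; filter-↭)
open import Data.List.Relation.Unary.All as All using (All; []; _∷_)
import Data.List.Relation.Unary.All.Properties as Allₚ
open import Data.List.Relation.Unary.AllPairs using (_∷_)
open import Data.List.Relation.Unary.Any using (here; there)
open import Data.List.Relation.Unary.Unique.Propositional using (Unique)
import Data.List.Relation.Unary.Unique.Propositional.Properties as Uniqueₚ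
open import Data.Maybe using (Maybe; just; nothing)
open import Data.Nat as ℕ using (ℕ; zero; suc; pred; z≤n; s≤s; _≡ᵇ_; _≤_; _∸_)
open import Data.Nat.Properties as ℕₚ using (≤-trans; ≤-refl; ≡ᵇ⇒≡; ≡⇒≡ᵇ; +-cancelˡ-≡; 1+n≰n)
open import Data.Nat.Solver using (module +-*-Solver)
open import Data.Product using (_×_; _,_; proj₁; proj₂; ∃; Σ; map₂)
open import Data.Product.Properties using (≡-dec)
open import Data.Sum using (_⊎_; inj₁; inj₂; [_,_]′)
open import Data.Vec as Vec using ([]; _∷_; tabulate)
open import Data.Vec.Properties using (lookup∘tabulate; lookup⇒[]=; []=⇒lookup)
open import Function using (_∘_; case_of_; id)
open import Function.Bundles using (mk⇔; Equivalence)
open import Induction.WellFounded using (Acc; acc; WellFounded; module Subrelation)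
import Relation.Binary.Construct.On as On
open import Relation.Binary.Definitions using (tri<; tri≈; tri>)
open import Relation.Binary.PropositionalEquality as ≡ using (_≡_; _≢_; subst; cong; cong₂)
open import Relation.Nullary using (¬_; Dec; yes; no; does; contradiction)
open import Relation.Nullary.Decidable using (_×-dec_; _⊎-dec_; _→-dec_; ¬?; from-yes; dec-true; dec-false; does-⇔; map′)

-- Truncation at v³ is the out-degree bound 2, and the factor x y z lowers it to 1 at x, y, z: a
-- surviving monomial of x y z P_G is x y z times a monomial of P_G. Working over 𝔽₂ discards the
-- signs in `diff`, so one odd coefficient suffices. The two exceptions are genuine: in both, y z
-- P_G = x² P_G, hence x y z P_G = x³ P_G = 0. The same identity rescues the critical case. If p′,
-- y, z is an exception in H, then y z acts as p′², so the coefficient with q² has weight q² p′².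
-- This weight is nonzero because q² p′ (q + p′) = q² p′² modulo q³, and (q + p′) P_H is the
-- polynomial of H + qp′. That graph arises by contracting p into p′, so no K₄ minor appears. A
-- vertex carrying weight cannot simply be deleted. Hence the structural input is stronger than the
-- existence of a vertex of degree at most two: such a vertex must be found off a given edge.

-- Truncated polynomials over 𝔽₂

module _ (S : CommutativeSemiring 0ℓ 0ℓ) where
  open CommutativeSemiring S
  open import Algebra.Solver.Ring.NaturalCoefficients.Default S

  -- This is S[t]/(t³): a triple lists the coefficients of 1, t and t².
  truncated : CommutativeSemiring 0ℓ 0ℓ
  truncated = record
    { Carrier = Carrier × Carrier × Carrier
    ; _≈_ = λ { (a , b , c) (d , e , f) → a ≈ d × b ≈ e × c ≈ f }
    ; _+_ = λ { (a , b , c) (d , e , f) → a + d , b + e , c + f }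
    ; _*_ = λ { (a , b , c) (d , e , f) → a * d , a * e + b * d , a * f + b * e + c * d }
    ; 0# = 0# , 0# , 0#
    ; 1# = 1# , 0# , 0#
    ; isCommutativeSemiring = record
      { isSemiring = record
        { isSemiringWithoutAnnihilatingZero = record
          { +-isCommutativeMonoid = record
            { isMonoid = record
              { isSemigroup = record
                { isMagma = record
                  { isEquivalence = record
                    { refl = refl , refl , refl
                    ; sym = λ { (p , q , r) → sym p , sym q , sym r }
                    ; trans = λ { (p , q , r) (s , t , u) → trans p s , trans q t , trans r u }
                    }
                  ; ∙-cong = λ { (p , q , r) (s , t , u) → +-cong p s , +-cong q t , +-cong r u }
                  }
                ; assoc = λ _ _ _ → +-assoc _ _ _ , +-assoc _ _ _ , +-assoc _ _ _
                }
              ; identity = (λ _ → +-identityˡ _ , +-identityˡ _ , +-identityˡ _)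
                         , (λ _ → +-identityʳ _ , +-identityʳ _ , +-identityʳ _)
              }
            ; comm = λ _ _ → +-comm _ _ , +-comm _ _ , +-comm _ _
            }
          ; *-cong = λ { (p , q , r) (s , t , u) →
              *-cong p s
              , +-cong (*-cong p t) (*-cong q s)
              , +-cong (+-cong (*-cong p u) (*-cong q t)) (*-cong r s) }
          ; *-assoc = λ { (a , b , c) (d , e , f) (g , h , i) →
              *-assoc a d g
              , solve 6 (λ a b d e g h → (a :* d) :* h :+ (a :* e :+ b :* d) :* g
                                      := a :* (d :* h :+ e :* g) :+ b :* (d :* g))
                      refl a b d e g h
              , solve 9 (λ a b c d e f g h i →
                  (a :* d) :* i :+ (a :* e :+ b :* d) :* h :+ (a :* f :+ b :* e :+ c :* d) :* g
                  := a :* (d :* i :+ e :* h :+ f :* g) :+ b :* (d :* h :+ e :* g) :+ c :* (d :* g))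
                  refl a b c d e f g h i }
          ; *-identity =
              (λ { (a , b , c) → *-identityˡ a
                , solve 2 (λ a b → con 1 :* b :+ con 0 :* a := b) refl a b
                , solve 3 (λ a b c → con 1 :* c :+ con 0 :* b :+ con 0 :* a := c) refl a b c })
            , (λ { (a , b , c) → *-identityʳ a
                , solve 2 (λ a b → a :* con 0 :+ b :* con 1 := b) refl a b
                , solve 3 (λ a b c → a :* con 0 :+ b :* con 0 :+ c :* con 1 := c) refl a b c })
          ; distrib =
              (λ { (a , b , c) (d , e , f) (g , h , i) → distribˡ a d g
                , solve 6 (λ a b d e g h → a :* (e :+ h) :+ b :* (d :+ g)
                                        := (a :* e :+ b :* d) :+ (a :* h :+ b :* g))
                        refl a b d e g h
                , solve 9 (λ a b c d e f g h i →
                    a :* (f :+ i) :+ b :* (e :+ h) :+ c :* (d :+ g)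
                    := (a :* f :+ b :* e :+ c :* d) :+ (a :* i :+ b :* h :+ c :* g))
                    refl a b c d e f g h i })
            , (λ { (a , b , c) (d , e , f) (g , h , i) → distribʳ a d g
                , solve 6 (λ a b d e g h → (d :+ g) :* b :+ (e :+ h) :* a
                                        := (d :* b :+ e :* a) :+ (g :* b :+ h :* a))
                        refl a b d e g h
                , solve 9 (λ a b c d e f g h i →
                    (d :+ g) :* c :+ (e :+ h) :* b :+ (f :+ i) :* a
                    := (d :* c :+ e :* b :+ f :* a) :+ (g :* c :+ h :* b :+ i :* a))
                    refl a b c d e f g h i })
          }
        ; zero =
            (λ { (a , b , c) → zeroˡ a
              , solve 2 (λ a b → con 0 :* b :+ con 0 :* a := con 0) refl a b
              , solve 3 (λ a b c → con 0 :* c :+ con 0 :* b :+ con 0 :* a := con 0) refl a b c })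
          , (λ { (a , b , c) → zeroʳ a
              , solve 2 (λ a b → a :* con 0 :+ b :* con 0 := con 0) refl a b
              , solve 3 (λ a b c → a :* con 0 :+ b :* con 0 :+ c :* con 0 := con 0) refl a b c })
        }
      ; *-comm = λ { (a , b , c) (d , e , f) → *-comm a d
          , solve 4 (λ a b d e → a :* e :+ b :* d := d :* b :+ e :* a) refl a b d e
          , solve 6 (λ a b c d e f → a :* f :+ b :* e :+ c :* d := d :* c :+ e :* b :+ f :* a)
                  refl a b c d e f }
      }
    }

-- 𝔽₂[x₀, …, xₙ₋₁] / (x₀³, …, xₙ₋₁³)
Poly : ℕ → CommutativeSemiring 0ℓ 0ℓ
Poly zero    = CommutativeRing.commutativeSemiring xor-∧-commutativeRing
Poly (suc n) = truncated (Poly n)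

private module M n = CommutativeSemiring (Poly n)

∣Poly∣ : ℕ → Set
∣Poly∣ n = CommutativeSemiring.Carrier (Poly n)

var : ∀ {n} → Fin n → ∣Poly∣ n
var {suc n} zero    = M.0# n , M.1# n , M.0# n
var {suc n} (suc v) = var v , M.0# n , M.0# n

-- Substitution of 0 for the variable `v`.
σ : ∀ {n} → Fin n → ∣Poly∣ n → ∣Poly∣ n
σ {suc n} zero    (a , _ , _) = a , M.0# n , M.0# n
σ {suc n} (suc v) (a , b , c) = σ v a , σ v b , σ v c

+-self : ∀ {n} (f : ∣Poly∣ n) → M._≈_ n (M._+_ n f f) (M.0# n)
+-self {zero}  true        = ≡.refl
+-self {zero}  false       = ≡.refl
+-self {suc n} (a , b , c) = +-self {n} a , +-self {n} b , +-self {n} c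

1≉0 : ∀ {n} → ¬ M._≈_ n (M.1# n) (M.0# n)
1≉0 {zero}  ()
1≉0 {suc n} (p , _) = 1≉0 {n} p

σ-0 : ∀ {n} (v : Fin n) → M._≈_ n (σ v (M.0# n)) (M.0# n)
σ-0 {suc n} zero    = M.refl n , M.refl n , M.refl n
σ-0 {suc n} (suc v) = σ-0 {n} v , σ-0 {n} v , σ-0 {n} v

σ-1 : ∀ {n} (v : Fin n) → M._≈_ n (σ v (M.1# n)) (M.1# n)
σ-1 {suc n} zero    = M.refl n , M.refl n , M.refl n
σ-1 {suc n} (suc v) = σ-1 {n} v , σ-0 {n} v , σ-0 {n} v

σ-+ : ∀ {n} (v : Fin n) f g → M._≈_ n (σ v (M._+_ n f g)) (M._+_ n (σ v f) (σ v g))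
σ-+ {suc n} zero    _ _ = M.refl n , M.sym n (M.+-identityˡ n _) , M.sym n (M.+-identityˡ n _)
σ-+ {suc n} (suc v) _ _ = σ-+ {n} v _ _ , σ-+ {n} v _ _ , σ-+ {n} v _ _

σ-* : ∀ {n} (v : Fin n) f g → M._≈_ n (σ v (M._*_ n f g)) (M._*_ n (σ v f) (σ v g))
σ-* {suc n} zero (a , _ , _) (d , _ , _) =
    M.refl n
  , solve 2 (λ a d → con 0 := a :* con 0 :+ con 0 :* d) (M.refl n) a d
  , solve 2 (λ a d → con 0 := a :* con 0 :+ con 0 :* con 0 :+ con 0 :* d) (M.refl n) a d
  where open import Algebra.Solver.Ring.NaturalCoefficients.Default (Poly n) using (solve; _:+_; _:*_; _:=_; con)
σ-* {suc n} (suc v) (a , b , c) (d , e , f) =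
    σ-* {n} v a d
  , M.trans n (σ-+ {n} v _ _) (M.+-cong n (σ-* {n} v a e) (σ-* {n} v b d))
  , M.trans n (σ-+ {n} v _ _)
      (M.+-cong n (M.trans n (σ-+ {n} v _ _) (M.+-cong n (σ-* {n} v a f) (σ-* {n} v b e)))
                  (σ-* {n} v c d))

σ-var : ∀ {n} {u v : Fin n} → u ≢ v → M._≈_ n (σ v (var u)) (var u)
σ-var {suc n} {zero}  {zero}  u≢v = contradiction ≡.refl u≢v
σ-var {suc n} {zero}  {suc v} u≢v = σ-0 {n} v , σ-1 {n} v , σ-0 {n} v
σ-var {suc n} {suc u} {zero}  u≢v = M.refl n , M.refl n , M.refl n
σ-var {suc n} {suc u} {suc v} u≢v =
  σ-var {n} (λ p → u≢v (≡.cong suc p)) , σ-0 {n} v , σ-0 {n} v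

var³ : ∀ {n} (v : Fin n) f →
       M._≈_ n (M._*_ n (var v) (M._*_ n (var v) (M._*_ n (var v) f))) (M.0# n)
var³ {suc n} zero (a , b , c) =
    solve 1 (λ a → o :* (o :* (o :* a)) := o) (M.refl n) a
  , solve 2 (λ a b → o :* (o :* (o :* b :+ ι :* a) :+ ι :* (o :* a)) :+ ι :* (o :* (o :* a)) := o)
            (M.refl n) a b
  , solve 3 (λ a b c →
      o :* (o :* (o :* c :+ ι :* b :+ o :* a) :+ ι :* (o :* b :+ ι :* a) :+ o :* (o :* a))
      :+ ι :* (o :* (o :* b :+ ι :* a) :+ ι :* (o :* a)) :+ o :* (o :* (o :* a)) := o)
            (M.refl n) a b c
  where
  open import Algebra.Solver.Ring.NaturalCoefficients.Default (Poly n)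
    using (solve; _:+_; _:*_; _:=_; con; Polynomial)
  o ι : ∀ {m} → Polynomial m
  o = con 0
  ι = con 1
var³ {suc n} (suc v) (a , b , c) =
    var³ {n} v a
  , M.trans n (solve 3 (λ x a b →
      x :* (x :* (x :* b :+ o :* a) :+ o :* (x :* a)) :+ o :* (x :* (x :* a))
      := x :* (x :* (x :* b))) (M.refl n) (var v) a b) (var³ {n} v b)
  , M.trans n (solve 4 (λ x a b c →
      x :* (x :* (x :* c :+ o :* b :+ o :* a) :+ o :* (x :* b :+ o :* a) :+ o :* (x :* a))
      :+ o :* (x :* (x :* b :+ o :* a) :+ o :* (x :* a)) :+ o :* (x :* (x :* a))
      := x :* (x :* (x :* c))) (M.refl n) (var v) a b c) (var³ {n} v c)
  where
  open import Algebra.Solver.Ring.NaturalCoefficients.Default (Poly n)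
    using (solve; _:+_; _:*_; _:=_; con; Polynomial)
  o : ∀ {m} → Polynomial m
  o = con 0

-- Multiplication by v² kills every term of `f` that contains v; the rest is `σ v f`, which becomes
-- the coefficient of v².
var²-cancel : ∀ {n} (v : Fin n) f →
              M._≈_ n (M._*_ n (var v) (M._*_ n (var v) f)) (M.0# n) →
              M._≈_ n (σ v f) (M.0# n)
var²-cancel {suc n} zero (a , b , c) (_ , _ , p) =
    M.trans n (solve 3 (λ a b c → a :=
      o :* (o :* c :+ ι :* b :+ o :* a) :+ ι :* (o :* b :+ ι :* a) :+ o :* (o :* a))
      (M.refl n) a b c) p
  , M.refl n , M.refl n
  where
  open import Algebra.Solver.Ring.NaturalCoefficients.Default (Poly n)
    using (solve; _:+_; _:*_; _:=_; con; Polynomial)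
  o ι : ∀ {m} → Polynomial m
  o = con 0
  ι = con 1
var²-cancel {suc n} (suc v) (a , b , c) (p , q , r) =
    var²-cancel {n} v a p
  , var²-cancel {n} v b (M.trans n (solve 3 (λ x a b →
      x :* (x :* b) := x :* (x :* b :+ o :* a) :+ o :* (x :* a)) (M.refl n) (var v) a b) q)
  , var²-cancel {n} v c (M.trans n (solve 4 (λ x a b c →
      x :* (x :* c) := x :* (x :* c :+ o :* b :+ o :* a) :+ o :* (x :* b :+ o :* a) :+ o :* (x :* a))
      (M.refl n) (var v) a b c) r)
  where
  open import Algebra.Solver.Ring.NaturalCoefficients.Default (Poly n)
    using (solve; _:+_; _:*_; _:=_; con; Polynomial)
  o : ∀ {m} → Polynomial m
  o = con 0

module Algebra₂ (n : ℕ) where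
  open CommutativeSemiring (Poly n) public
    using (_≈_; _+_; _*_; 0#; 1#; refl; sym; trans; reflexive; setoid; +-cong; +-congˡ; +-congʳ; *-cong
          ; *-congˡ; *-congʳ; zeroˡ; zeroʳ; *-identityˡ; *-identityʳ; *-comm; *-assoc; +-identityˡ; +-identityʳ)

  private
    coefficients = CommutativeRing.rawRing xor-∧-commutativeRing

    -- With 𝔽₂ as coefficient ring, the solver cancels equal terms in pairs.
    scalars : coefficients -Raw-AlmostCommutative⟶ fromCommutativeSemiring (Poly n)
    scalars = record
      { ⟦_⟧    = λ b → if b then 1# else 0#
      ; +-homo = λ { true true   → sym (+-self {n} 1#)
                   ; true false  → sym (+-identityʳ 1#)
                   ; false b     → sym (+-identityˡ _) }
      ; *-homo = λ { true b → sym (*-identityˡ _) ; false b → sym (zeroˡ _) }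
      ; -‿homo = λ _ → refl
      ; 0-homo = refl
      ; 1-homo = refl
      }

    scalars≟ : ∀ a b → Maybe ((if a then 1# else 0#) ≈ (if b then 1# else 0#))
    scalars≟ true  true  = just refl
    scalars≟ false false = just refl
    scalars≟ _     _     = nothing

  open import Algebra.Solver.Ring coefficients (fromCommutativeSemiring (Poly n)) scalars scalars≟ public
    using (solve; _:+_; _:*_; _:=_; con)

  NZ : ∣Poly∣ n → Set
  NZ f = ¬ f ≈ 0#

  NZ-resp : ∀ {f g} → f ≈ g → NZ f → NZ g
  NZ-resp p nz q = nz (trans p q)

  NZ-factor : ∀ f {g} → NZ (f * g) → NZ g
  NZ-factor f nz q = nz (trans (*-congˡ q) (zeroʳ f))

  -- Absence of `v` is expressed as invariance under v ↦ 0, which passes directly to sums and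
  -- products.
  Free : Fin n → ∣Poly∣ n → Set
  Free v f = σ v f ≈ f

  Free-1 : ∀ {v : Fin n} → Free v 1#
  Free-1 {v} = σ-1 {n} v

  Free-var : ∀ {u v : Fin n} → u ≢ v → Free v (var u)
  Free-var = σ-var {n}

  Free-+ : ∀ {v f g} → Free v f → Free v g → Free v (f + g)
  Free-+ {v} {f} {g} p q = trans (σ-+ {n} v f g) (+-cong p q)

  Free-* : ∀ {v f g} → Free v f → Free v g → Free v (f * g)
  Free-* {v} {f} {g} p q = trans (σ-* {n} v f g) (*-cong p q)

  infixr 7 _F*_
  infixr 6 _F+_
  _F*_ = Free-*
  _F+_ = Free-+

  private
    cancel : ∀ v f → Free v f → var v * (var v * f) ≈ 0# → f ≈ 0#
    cancel v f p q = trans (sym p) (var²-cancel {n} v f q)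

  cube : ∀ (v : Fin n) {f} → var v * (var v * (var v * f)) ≈ 0#
  cube v = var³ {n} v _

  module _ (v : Fin n) (K A B C : ∣Poly∣ n) (a : Free v A) (b : Free v B) (c : Free v C)
           (eq : var v * (var v * (var v * K)) + var v * (var v * A) + var v * B + C ≈ 0#) where
    private
      x = var v
      -- Multiplication by v² leaves only C v². Once C = 0, multiplication by v leaves only B v²,
      -- and then A remains.
      C≈0 : C ≈ 0#
      C≈0 = cancel v C c
        (trans (sym (trans
          (solve 5 (λ x K A B C → x :* (x :* (x :* (x :* (x :* K)) :+ x :* (x :* A) :+ x :* B :+ C))
             := x :* (x :* (x :* (x :* (x :* K) :+ x :* A :+ B))) :+ x :* (x :* C)) refl x K A B C)
          (trans (+-congʳ (cube v)) (+-identityˡ _))))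
        (trans (*-congˡ (*-congˡ eq)) (trans (*-congˡ (zeroʳ x)) (zeroʳ x))))
      B≈0 : B ≈ 0#
      B≈0 = cancel v B b
        (trans (sym (trans (+-congˡ (trans (*-congˡ C≈0) (zeroʳ x))) (trans (+-identityʳ _) (trans
          (solve 4 (λ x K A B → x :* (x :* (x :* (x :* K)) :+ x :* (x :* A) :+ x :* B)
             := x :* (x :* (x :* (x :* K :+ A))) :+ x :* (x :* B)) refl x K A B)
          (trans (+-congʳ (cube v)) (+-identityˡ _))))))
        (trans (solve 5 (λ x K A B C → x :* (x :* (x :* (x :* K)) :+ x :* (x :* A) :+ x :* B) :+ x :* C
             := x :* (x :* (x :* (x :* K)) :+ x :* (x :* A) :+ x :* B :+ C)) refl x K A B C)
          (trans (*-congˡ eq) (zeroʳ x))))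

    coefficient₁≈0 : B ≈ 0#
    coefficient₁≈0 = B≈0

    coefficient₂≈0 : A ≈ 0#
    coefficient₂≈0 = cancel v A a
      (trans (sym (trans (+-cong (+-cong (+-congʳ (cube v)) (trans (*-congˡ B≈0) (zeroʳ x))) C≈0)
        (trans (+-identityʳ _) (trans (+-identityʳ _) (+-identityˡ _))))) eq)

  -- `K` may contain `v`: as v³ = 0, it collects all higher powers that an expansion produces.
  coefficient₂ : ∀ v K A B C {F} → Free v A → Free v B → Free v C →
    F ≈ var v * (var v * (var v * K)) + var v * (var v * A) + var v * B + C → NZ A → NZ F
  coefficient₂ v K A B C a b c e nz eq =
    nz (coefficient₂≈0 v K A B C a b c (trans (sym e) eq))

  coefficient₁ : ∀ v K A B C {F} → Free v A → Free v B → Free v C →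
    F ≈ var v * (var v * (var v * K)) + var v * (var v * A) + var v * B + C → NZ B → NZ F
  coefficient₁ v K A B C a b c e nz eq =
    nz (coefficient₁≈0 v K A B C a b c (trans (sym e) eq))

-- Graphs on a fixed vertex set

-- Deletion and contraction keep all of `Fin n` and only isolate vertices, so the polynomials of all
-- graphs in the induction lie in one ring.
record Gr (n : ℕ) : Set₁ where
  field
    Edge  : Fin n → Fin n → Set
    edge? : ∀ u v → Dec (Edge u v)
    esym  : ∀ {u v} → Edge u v → Edge v u
    eirr  : ∀ {v} → ¬ Edge v v
open Gr public

edge≢ : ∀ {n} (g : Gr n) {u v} → Edge g u v → u ≢ v
edge≢ g e ≡.refl = eirr g e

_⊑_ : ∀ {n} → Gr n → Gr n → Set
h ⊑ g = ∀ {u v} → Edge h u v → Edge g u v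

del : ∀ {n} → Gr n → Fin n → Gr n
del g x = record
  { Edge  = λ u v → Edge g u v × u ≢ x × v ≢ x
  ; edge? = λ u v → edge? g u v ×-dec ¬? (u ≟ x) ×-dec ¬? (v ≟ x)
  ; esym  = λ (e , p , q) → esym g e , q , p
  ; eirr  = λ (e , _) → eirr g e
  }

rem : ∀ {n} → Gr n → Fin n → Fin n → Gr n
rem g p q = record
  { Edge  = λ u v → Edge g u v × ¬ (u ≡ p × v ≡ q) × ¬ (u ≡ q × v ≡ p)
  ; edge? = λ u v → edge? g u v ×-dec ¬? (u ≟ p ×-dec v ≟ q) ×-dec ¬? (u ≟ q ×-dec v ≟ p)
  ; esym  = λ (e , a , b) → esym g e , (λ (x , y) → b (y , x)) , (λ (x , y) → a (y , x))
  ; eirr  = λ (e , _) → eirr g e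
  }

-- q is contracted into p and stays behind as an isolated vertex
con/ : ∀ {n} → Gr n → Fin n → Fin n → Gr n
con/ g p q = record
  { Edge  = λ u v → u ≢ v × u ≢ q × v ≢ q × (Edge g u v ⊎ (u ≡ p × Edge g q v) ⊎ (v ≡ p × Edge g u q))
  ; edge? = λ u v → ¬? (u ≟ v) ×-dec ¬? (u ≟ q) ×-dec ¬? (v ≟ q) ×-dec
                    (edge? g u v ⊎-dec (u ≟ p ×-dec edge? g q v) ⊎-dec (v ≟ p ×-dec edge? g u q))
  ; esym  = λ { (a , b , c , inj₁ e)               → a ∘ ≡.sym , c , b , inj₁ (esym g e)
              ; (a , b , c , inj₂ (inj₁ (e , f)))  → a ∘ ≡.sym , c , b , inj₂ (inj₂ (e , esym g f))
              ; (a , b , c , inj₂ (inj₂ (e , f)))  → a ∘ ≡.sym , c , b , inj₂ (inj₁ (e , esym g f)) }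
  ; eirr  = λ (a , _) → a ≡.refl
  }

-- The graph polynomial

allPairs-cartesian : ∀ {A : Set} (xs ys : List A) →
  concatMap (λ u → map (λ v → (u , v)) ys) xs ≡ cartesianProduct xs ys
allPairs-cartesian []       ys = ≡.refl
allPairs-cartesian (x ∷ xs) ys = ≡.cong (map (x ,_) ys ++_) (allPairs-cartesian xs ys)

allPairs-unique : ∀ n → Unique (allPairs n)
allPairs-unique n = subst Unique (≡.sym (allPairs-cartesian (allFin n) (allFin n)))
  (Uniqueₚ.cartesianProduct⁺ (Uniqueₚ.allFin⁺ n) (Uniqueₚ.allFin⁺ n))

∈-allPairs : ∀ {n} (u v : Fin n) → (u , v) ∈ allPairs n
∈-allPairs {n} u v = subst ((u , v) ∈_) (≡.sym (allPairs-cartesian (allFin n) (allFin n)))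
  (∈-cartesianProduct⁺ (∈-allFin u) (∈-allFin v))

module _ {n : ℕ} where
  open Algebra₂ n

  ∏ : {A : Set} → (A → ∣Poly∣ n) → List A → ∣Poly∣ n
  ∏ f []       = 1#
  ∏ f (a ∷ as) = f a * ∏ f as

  ∏-cong : ∀ {A : Set} {f g : A → ∣Poly∣ n} {as} → All (λ a → f a ≈ g a) as → ∏ f as ≈ ∏ g as
  ∏-cong []       = refl
  ∏-cong (p ∷ ps) = *-cong p (∏-cong ps)

  ∏-single : ∀ {A : Set} (f g : A → ∣Poly∣ n) {a as} → Unique as → a ∈ as →
             (∀ b → b ≢ a → f b ≈ g b) → g a ≈ 1# → ∏ f as ≈ f a * ∏ g as
  ∏-single f g (p ∷ ps) (here ≡.refl) off one = *-congˡ
    (trans (∏-cong (All.map (λ a≢b → off _ (a≢b ∘ ≡.sym)) p))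
           (sym (trans (*-congʳ one) (*-identityˡ _))))
  ∏-single f g {a} {b ∷ as} (p ∷ ps) (there a∈) off one = trans
    (*-cong (off b (All.lookup p a∈)) (∏-single f g ps a∈ off one))
    (solve 3 (λ x y z → x :* (y :* z) := y :* (x :* z)) refl (g b) (f a) (∏ g as))

  Free-∏ : ∀ {A : Set} {v} (f : A → ∣Poly∣ n) as → (∀ a → Free v (f a)) → Free v (∏ f as)
  Free-∏ f []       p = Free-1
  Free-∏ f (a ∷ as) p = p a F* Free-∏ f as p

  Edge< : Gr n → Fin n × Fin n → Set
  Edge< g (u , v) = u Fin.< v × Edge g u v

  edge<? : ∀ g e → Dec (Edge< g e)
  edge<? g (u , v) = (u Finₚ.<? v) ×-dec edge? g u v

  -- An edge counts once, at its increasing pair. The factor 1 elsewhere lets the product run over a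
  -- list that does not depend on `g`.
  factor : Gr n → Fin n × Fin n → ∣Poly∣ n
  factor g e@(u , v) = if does (edge<? g e) then var u + var v else 1#

  factor-yes : ∀ (g : Gr n) u v → Edge< g (u , v) → factor g (u , v) ≡ var u + var v
  factor-yes g u v p rewrite dec-true (edge<? g (u , v)) p = ≡.refl

  factor-no : ∀ (g : Gr n) e → ¬ Edge< g e → factor g e ≡ 1#
  factor-no g e p rewrite dec-false (edge<? g e) p = ≡.refl

  factor-cong : ∀ (g h : Gr n) e → (Edge< g e → Edge< h e) → (Edge< h e → Edge< g e) → factor g e ≡ factor h e
  factor-cong g h e@(u , v) p q = ≡.cong (λ b → if b then var u + var v else 1#)
    (does-⇔ (mk⇔ p q) (edge<? g e) (edge<? h e))

  opaque
    P : Gr n → ∣Poly∣ n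
    P g = ∏ (factor g) (allPairs n)

    P-cong : ∀ (g h : Gr n) → g ⊑ h → h ⊑ g → P g ≈ P h
    P-cong g h p q = ∏-cong (All.universal
      (λ e → reflexive (factor-cong g h e (λ (a , b) → a , p b) (λ (a , b) → a , q b))) (allPairs n))

    P-empty : ∀ (g : Gr n) → (∀ u v → ¬ Edge g u v) → P g ≈ 1#
    P-empty g none = go (allPairs n)
      where
      go : ∀ es → ∏ (factor g) es ≈ 1#
      go []             = refl
      go ((u , v) ∷ es) = trans (*-cong (reflexive (factor-no g (u , v) (λ (_ , e) → none u v e))) (go es))
                                (*-identityˡ _)

    Free-P : ∀ (g : Gr n) v → (∀ u → ¬ Edge g v u) → Free v (P g)
    Free-P g v iso = Free-∏ (factor g) (allPairs n) go
      where
      go : ∀ e → Free v (factor g e)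
      go (a , b) with edge<? g (a , b)
      ... | yes p@(_ , e) = subst (Free v) (≡.sym (factor-yes g a b p))
        (Free-var (λ { ≡.refl → iso _ e }) F+ Free-var (λ { ≡.refl → iso _ (esym g e) }))
      ... | no ¬p         = subst (Free v) (≡.sym (factor-no g (a , b) ¬p)) Free-1

    P-rem< : ∀ (g : Gr n) p q → p Fin.< q → Edge g p q → P g ≈ (var p + var q) * P (rem g p q)
    P-rem< g p q p<q e = trans
      (∏-single (factor g) (factor (rem g p q)) (allPairs-unique n) (∈-allPairs p q)
        (λ { (u , v) b≢ → reflexive (factor-cong g (rem g p q) (u , v)
              (λ (l , f) → l , f , (λ { (≡.refl , ≡.refl) → b≢ ≡.refl })
                                 , (λ { (≡.refl , ≡.refl) → Finₚ.<-asym l p<q }))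
              (λ (l , f , _) → l , f)) })
        (reflexive (factor-no (rem g p q) (p , q) (λ (_ , _ , f , _) → f (≡.refl , ≡.refl)))))
      (*-congʳ (reflexive (factor-yes g p q (p<q , e))))

    P-rem : ∀ (g : Gr n) p q → Edge g p q → P g ≈ (var p + var q) * P (rem g p q)
    P-rem g p q e with Finₚ.<-cmp p q
    ... | tri< l _ _      = P-rem< g p q l e
    ... | tri≈ _ ≡.refl _ = contradiction e (eirr g)
    ... | tri> _ _ l      = trans (P-rem< g q p l (esym g e))
      (*-cong (solve 2 (λ a b → a :+ b := b :+ a) refl (var q) (var p))
              (P-cong (rem g q p) (rem g p q) (λ (a , b , c) → a , c , b) (λ (a , b , c) → a , c , b)))

  P-edge : ∀ (g h : Gr n) p q → Edge g p q → ¬ Edge h p q → h ⊑ g →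
           (∀ {u v} → Edge g u v → Edge h u v ⊎ (u ≡ p × v ≡ q) ⊎ (u ≡ q × v ≡ p)) →
           P g ≈ (var p + var q) * P h
  P-edge g h p q e ¬e h⊑g back = trans (P-rem g p q e) (*-congˡ (P-cong (rem g p q) h
    (λ (f , a , b) → case back f of λ { (inj₁ r) → r ; (inj₂ (inj₁ r)) → contradiction r a
                                      ; (inj₂ (inj₂ r)) → contradiction r b })
    (λ f → h⊑g f , (λ { (≡.refl , ≡.refl) → ¬e f }) , (λ { (≡.refl , ≡.refl) → ¬e (esym h f) }))))

-- A vertex of degree one or two: `a` and `b` may coincide.
record Leaf {n} (g : Gr n) (w : Fin n) : Set where
  constructor leaf
  field
    {a b} : Fin n
    wa    : Edge g w a
    wb    : Edge g w b
    only  : ∀ {u} → Edge g w u → u ≡ a ⊎ u ≡ b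

mkLeaf : ∀ {n} (g : Gr n) {w} a b → (∃ λ u → Edge g w u) →
         (∀ {u} → Edge g w u → u ≡ a ⊎ u ≡ b) → Leaf g w
mkLeaf g {w} a b (u , e) f with edge? g w a | edge? g w b
... | yes p | yes q = leaf p q f
... | yes p | no ¬q = leaf p p λ e → case f e of λ { (inj₁ r) → inj₁ r ; (inj₂ ≡.refl) → contradiction e ¬q }
... | no ¬p | yes q = leaf q q λ e → case f e of λ { (inj₂ r) → inj₁ r ; (inj₁ ≡.refl) → contradiction e ¬p }
... | no ¬p | no ¬q = case f e of λ { (inj₁ ≡.refl) → contradiction e ¬p ; (inj₂ ≡.refl) → contradiction e ¬q }

module _ {n : ℕ} where
  open Algebra₂ n

  P-leaf₁ : ∀ (g : Gr n) w a → Edge g w a → (∀ {u} → Edge g w u → u ≡ a) → P g ≈ (var w + var a) * P (del g w)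
  P-leaf₁ g w a e only = P-edge g (del g w) w a e (λ (_ , p , _) → p ≡.refl) proj₁ back
    where
    back : ∀ {u v} → Edge g u v → Edge (del g w) u v ⊎ (u ≡ w × v ≡ a) ⊎ (u ≡ a × v ≡ w)
    back {u} {v} f with u ≟ w | v ≟ w
    ... | yes ≡.refl | _          = inj₂ (inj₁ (≡.refl , only f))
    ... | no _       | yes ≡.refl = inj₂ (inj₂ (only (esym g f) , ≡.refl))
    ... | no u≢      | no v≢      = inj₁ (f , u≢ , v≢)

  P-leaf₂ : ∀ (g : Gr n) w a b → a ≢ b → Edge g w a → Edge g w b → (∀ {u} → Edge g w u → u ≡ a ⊎ u ≡ b) →
            P g ≈ (var w + var a) * ((var w + var b) * P (del g w))
  P-leaf₂ g w a b a≢b wa wb only = trans (P-rem g w a wa) (*-congˡ (trans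
    (P-leaf₁ h w b (wb , (λ (_ , p) → a≢b (≡.sym p)) , (λ (p , _) → edge≢ g wa p))
      (λ (e , p , q) → case only e of λ { (inj₁ r) → contradiction (≡.refl , r) p ; (inj₂ r) → r }))
    (*-congˡ (P-cong (del h w) (del g w)
      (λ ((e , _) , p , q) → e , p , q)
      (λ (e , p , q) → (e , (λ (r , _) → p r) , (λ (_ , r) → q r)) , p , q)))))
    where h = rem g w a

  Free-del : ∀ (g : Gr n) w → Free w (P (del g w))
  Free-del g w = Free-P (del g w) w (λ _ (_ , p , _) → p ≡.refl)

  -- A leaf can be made the tail of all its edges.
  NZ-del : ∀ (g : Gr n) {w} m → Leaf g w → Free w m → NZ (m * P (del g w)) → NZ (m * P g)
  NZ-del g {w} m (leaf {a} {b} wa wb only) fm nz with a ≟ b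
  ... | yes ≡.refl = coefficient₁ w 0# 0# (m * P (del g w)) (m * (var a * P (del g w)))
    (σ-0 {n} w) (fm F* Free-del g w) (fm F* Free-var (edge≢ g wa ∘ ≡.sym) F* Free-del g w)
    (trans (*-congˡ (P-leaf₁ g w a wa (λ e → [ (λ r → r) , (λ r → r) ]′ (only e))))
      (solve 4 (λ w a m Q → m :* ((w :+ a) :* Q) := w :* (w :* (w :* con false)) :+ w :* (w :* con false)
        :+ w :* (m :* Q) :+ m :* (a :* Q)) refl (var w) (var a) m (P (del g w)))) nz
  ... | no a≢b = coefficient₂ w 0# (m * Q) (m * ((var a + var b) * Q)) (m * (var a * (var b * Q)))
    (fm F* fQ) (fm F* (fa F+ fb) F* fQ) (fm F* fa F* fb F* fQ)
    (trans (*-congˡ (P-leaf₂ g w a b a≢b wa wb only))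
      (solve 5 (λ w a b m Q → m :* ((w :+ a) :* ((w :+ b) :* Q)) := w :* (w :* (w :* con false)) :+ w :* (w :* (m :* Q))
        :+ w :* (m :* ((a :+ b) :* Q)) :+ m :* (a :* (b :* Q))) refl (var w) (var a) (var b) m Q)) nz
    where
    Q  = P (del g w)
    fQ = Free-del g w
    fa = Free-var (edge≢ g wa ∘ ≡.sym)
    fb = Free-var (edge≢ g wb ∘ ≡.sym)

  infix 4 _∼_[_]
  -- Equality modulo the annihilator of `P g`.
  _∼_[_] : ∣Poly∣ n → ∣Poly∣ n → Gr n → Set
  f ∼ h [ g ] = f * P g ≈ h * P g

  -- (u + a + b) (u + a) (u + b) (a + b) is a combination of cubes.
  triangle : ∀ (g : Gr n) {u a b} → Edge g u a → Edge g u b → Edge g a b → var u ∼ var a + var b [ g ]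
  triangle g {u} {a} {b} ua ub ab = trans (*-congˡ eq) (trans
    (solve 4 (λ u a b Q →
      u :* ((u :+ a) :* ((u :+ b) :* ((a :+ b) :* Q))) :=
      (a :+ b) :* ((u :+ a) :* ((u :+ b) :* ((a :+ b) :* Q)))
        :+ (u :* (u :* (u :* ((a :+ b) :* Q)))
        :+ (a :* (a :* (a :* ((u :+ b) :* Q)))
        :+ b :* (b :* (b :* ((u :+ a) :* Q)))))) refl (var u) (var a) (var b) Q)
    (trans (+-cong (*-congˡ (sym eq))
      (trans (+-cong (cube u) (trans (+-cong (cube a) (cube b)) (+-identityˡ _))) (+-identityˡ _)))
      (+-identityʳ _)))
    where
    g₁ = rem g u a
    g₂ = rem g₁ u b
    Q  = P (rem g₂ a b)
    eq : P g ≈ (var u + var a) * ((var u + var b) * ((var a + var b) * Q))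
    eq = trans (P-rem g u a ua) (*-congˡ (trans
      (P-rem g₁ u b (ub , (λ (_ , p) → edge≢ g ab (≡.sym p)) , (λ (p , _) → edge≢ g ua p)))
      (*-congˡ (P-rem g₂ a b
        ((ab , (λ (p , _) → edge≢ g ua (≡.sym p)) , (λ (_ , p) → edge≢ g ub (≡.sym p)))
        , (λ (p , _) → edge≢ g ua (≡.sym p)) , (λ (p , _) → edge≢ g ab p))))))

  -- Times the factor a + b of `P g`, the quadratic form is a³ + b³ = 0.
  edge-quadratic : ∀ (g : Gr n) {a b} → Edge g a b →
    (var a * var a + (var a * var b + var b * var b)) * P g ≈ 0#
  edge-quadratic g {a} {b} e = trans (*-congˡ (P-rem g a b e)) (trans
    (solve 3 (λ a b Q → (a :* a :+ (a :* b :+ b :* b)) :* ((a :+ b) :* Q) :=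
       a :* (a :* (a :* Q)) :+ b :* (b :* (b :* Q))) refl (var a) (var b) (P (rem g a b)))
    (trans (+-cong (cube a) (cube b)) (+-identityˡ _)))

-- K₄ minors and contraction

data Walk {n} (g : Gr n) (Q : Fin n → Set) : Fin n → Fin n → Set where
  here : ∀ {u} → Walk g Q u u
  step : ∀ {u w v} → Edge g u w → Q w → Walk g Q w v → Walk g Q u v

_++ʷ_ : ∀ {n} {g : Gr n} {Q u v w} → Walk g Q u v → Walk g Q v w → Walk g Q u w
here       ++ʷ q = q
step e r p ++ʷ q = step e r (p ++ʷ q)

map-walk : ∀ {n} {h g : Gr n} {Q u v} → h ⊑ g → Walk h Q u v → Walk g Q u v
map-walk i here         = here
map-walk i (step e r p) = step (i e) r (map-walk i p)

K₄Minor : ∀ {n} → Gr n → Set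
K₄Minor {n} g = Σ (Fin n → Maybe (Fin 4)) λ b →
    (∀ i → ∃ λ v → b v ≡ just i)
  × (∀ i u v → b u ≡ just i → b v ≡ just i → Walk g (λ w → b w ≡ just i) u v)
  × (∀ i j → i ≢ j → ∃ λ u → ∃ λ v → b u ≡ just i × b v ≡ just j × Edge g u v)

minor-mono : ∀ {n} {h g : Gr n} → h ⊑ g → K₄Minor h → K₄Minor g
minor-mono i (b , ne , con , adj) = b , ne
  , (λ k u v p q → map-walk i (con k u v p q))
  , λ k l k≢l → let (u , v , p , q , e) = adj k l k≢l in u , v , p , q , i e

module _ {n} (g : Gr n) {p q} (pq : Edge g p q) where
  private
    h = con/ g p q

    extend : (Fin n → Maybe (Fin 4)) → Fin n → Maybe (Fin 4)
    extend b v with v ≟ q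
    ... | yes _ = b p
    ... | no _  = b v

    extend-q : ∀ b → extend b q ≡ b p
    extend-q b with q ≟ q
    ... | yes _ = ≡.refl
    ... | no ¬r = contradiction ≡.refl ¬r

    extend-≢ : ∀ b {v} → v ≢ q → extend b v ≡ b v
    extend-≢ b {v} v≢q with v ≟ q
    ... | yes r = contradiction r v≢q
    ... | no _  = ≡.refl

    other : (i : Fin 4) → ∃ λ j → i ≢ j
    other zero    = suc zero , λ ()
    other (suc _) = zero , λ ()

    module _ (b : Fin n → Maybe (Fin 4)) (i : Fin 4) where
      InBranch : Fin n → Set
      InBranch w = extend b w ≡ just i

      -- An edge of the contraction at `p` may stem from an edge at `q`; the walk then takes a
      -- detour over `pq`, and `q` is in the branch of `p`.
      lift : ∀ {u v} → b u ≡ just i → Walk h (λ w → b w ≡ just i) u v → Walk g InBranch u v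
      lift _  here = here
      lift bu (step (_ , _ , w≢q , inj₁ e) bw r) =
        step e (≡.trans (extend-≢ b w≢q) bw) (lift bw r)
      lift bu (step (_ , _ , w≢q , inj₂ (inj₁ (≡.refl , e))) bw r) =
        step pq (≡.trans (extend-q b) bu) (step e (≡.trans (extend-≢ b w≢q) bw) (lift bw r))
      lift bu (step (_ , _ , w≢q , inj₂ (inj₂ (≡.refl , e))) bw r) =
        step e (≡.trans (extend-q b) bw) (step (esym g pq) (≡.trans (extend-≢ b w≢q) bw) (lift bw r))

      representative : ∀ u → InBranch u →
        ∃ λ u′ → b u′ ≡ just i × Walk g InBranch u u′ × Walk g InBranch u′ u
      representative u bu with u ≟ q
      ... | no _       = u , bu , here , here
      ... | yes ≡.refl = p , bu
        , step (esym g pq) (≡.trans (extend-≢ b (edge≢ g pq)) bu) here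
        , step pq (≡.trans (extend-q b) bu) here

  minor-con : K₄Minor h → K₄Minor g
  minor-con (b , _ , con , adj) = extend b
    -- The given member of the branch might be `q`, whose label has been overwritten. An end of an
    -- edge to another branch is never `q`.
    , (λ i → let (j , i≢j) = other i ; (u , _ , bu , _ , (_ , u≢q , _)) = adj i j i≢j
             in u , ≡.trans (extend-≢ b u≢q) bu)
    , (λ i u v bu bv → let (u′ , bu′ , f , _) = representative b i u bu
                           (v′ , bv′ , _ , f′) = representative b i v bv
                       in f ++ʷ (lift b i bu′ (con i u′ v′ bu′ bv′) ++ʷ f′))
    , λ i j i≢j → case adj i j i≢j of λ
      { (u , v , bu , bv , (_ , u≢q , v≢q , inj₁ e)) →
          u , v , ≡.trans (extend-≢ b u≢q) bu , ≡.trans (extend-≢ b v≢q) bv , e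
      ; (u , v , bu , bv , (_ , u≢q , v≢q , inj₂ (inj₁ (≡.refl , e)))) →
          q , v , ≡.trans (extend-q b) bu , ≡.trans (extend-≢ b v≢q) bv , e
      ; (u , v , bu , bv , (_ , u≢q , v≢q , inj₂ (inj₂ (≡.refl , e)))) →
          u , q , ≡.trans (extend-≢ b u≢q) bu , ≡.trans (extend-q b) bv , e }

clique-minor : ∀ {n} (g : Gr n) (f : Fin 4 → Fin n) → (∀ {i j} → i ≢ j → Edge g (f i) (f j)) → K₄Minor g
clique-minor {n} g f e = b
  , (λ i → f i , b-f i)
  , (λ i u v p q → subst (Walk g _ u) (≡.trans (≡.sym (b⁻¹ p)) (b⁻¹ q)) here)
  , λ i j i≢j → f i , f j , b-f i , b-f j , e i≢j
  where
  b : Fin n → Maybe (Fin 4)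
  b v with any? (λ i → f i ≟ v)
  ... | yes (i , _) = just i
  ... | no _        = nothing

  b⁻¹ : ∀ {v i} → b v ≡ just i → f i ≡ v
  b⁻¹ {v} p with any? (λ i → f i ≟ v)
  b⁻¹ ≡.refl | yes (i , q) = q

  b-f : ∀ i → b (f i) ≡ just i
  b-f i with any? (λ j → f j ≟ f i)
  ... | no ¬p       = contradiction (i , ≡.refl) ¬p
  ... | yes (j , p) with j ≟ i
  ...   | yes ≡.refl = ≡.refl
  ...   | no j≢i     = contradiction p (edge≢ g (e j≢i))

-- Induction on the set of non-isolated vertices

NonIsolated : ∀ {n} → Gr n → Fin n → Set
NonIsolated g v = ∃ λ u → Edge g v u

nonIsolated? : ∀ {n} (g : Gr n) v → Dec (NonIsolated g v)
nonIsolated? g v = any? (edge? g v)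

_≺_ : ∀ {n} → Gr n → Gr n → Set
h ≺ g = (∀ {v} → NonIsolated h v → NonIsolated g v) × ∃ λ w → NonIsolated g w × ¬ NonIsolated h w

≺-trans : ∀ {n} (f g h : Gr n) → f ≺ g → g ≺ h → f ≺ h
≺-trans _ _ _ (i , w , p , q) (j , _) = (λ x → j (i x)) , w , j p , q

≺-wellFounded : ∀ {n} → WellFounded (_≺_ {n})
≺-wellFounded {n} = Subrelation.wellFounded (λ {h} {g} → sub {h} {g}) (On.wellFounded support ⊂-wellFounded)
  where
  support : Gr n → Subset n
  support g = tabulate (λ v → does (nonIsolated? g v))

  ∈⁺ : ∀ {g : Gr n} {v} → NonIsolated g v → v ∈ₛ support g
  ∈⁺ {g} {v} p = lookup⇒[]= v _ (≡.trans (lookup∘tabulate _ v) (dec-true (nonIsolated? g v) p))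

  ∈⁻ : ∀ {g : Gr n} {v} → v ∈ₛ support g → NonIsolated g v
  ∈⁻ {g} {v} p with nonIsolated? g v in eq
  ... | yes q = q
  ... | no ¬q = case ≡.trans (≡.sym ([]=⇒lookup p))
                  (≡.trans (lookup∘tabulate _ v) (dec-false (nonIsolated? g v) ¬q)) of λ ()

  sub : ∀ {h g : Gr n} → h ≺ g → support h ⊂ support g
  sub {h} {g} (i , w , p , ¬q) = (λ x → ∈⁺ {g} (i (∈⁻ {h} x))) , w , ∈⁺ {g} p , λ x → ¬q (∈⁻ {h} x)

del-≺ : ∀ {n} (g : Gr n) {v} → NonIsolated g v → del g v ≺ g
del-≺ g {v} p = (λ (u , e , _) → u , e) , v , p , λ (_ , _ , r , _) → r ≡.refl

con-≺ : ∀ {n} (g : Gr n) {p q} → Edge g p q → con/ g p q ≺ g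
con-≺ g {p} {q} pq =
    (λ { (u , _ , _ , _ , inj₁ e) → u , e
       ; (u , _ , _ , _ , inj₂ (inj₁ (≡.refl , e))) → q , pq
       ; (u , _ , _ , _ , inj₂ (inj₂ (≡.refl , e))) → q , e })
  , q , (p , esym g pq) , λ (_ , _ , r , _) → r ≡.refl

-- Vertices of degree one or two off a given edge

K₄-free : ∀ {n} → Gr n → Set
K₄-free g = ¬ K₄Minor g

leaf-nonIsolated : ∀ {n} {g : Gr n} {w} → Leaf g w → NonIsolated g w
leaf-nonIsolated l = _ , Leaf.wa l

-- Contracting pq exposes a vertex w with neighbours p, q and at most one more, r; contracting w into r
-- then exposes a leaf unless p, q, w, r form a K₄.
leaf-off-edge : ∀ {n} (g : Gr n) → Acc _≺_ g → K₄-free g → ∀ {p q} → Edge g p q →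
  (∃ λ a → a ≢ p × a ≢ q × NonIsolated g a) → ∃ λ w → w ≢ p × w ≢ q × Leaf g w
leaf-off-edge {n} g (acc rec) free {p} {q} pq (a , a≢p , a≢q , b , ab)
  with any? (λ u → ¬? (u ≟ p) ×-dec ¬? (u ≟ q) ×-dec (edge? g p u ⊎-dec edge? g q u))
-- No edge leaves {p, q}, so `a` lies in another component, which the deletion of `p` and `q` does
-- not touch.
... | no none = case any? (λ u → ¬? (u ≟ a) ×-dec ¬? (u ≟ b) ×-dec nonIsolated? h u) of λ
      { (yes other) → let (w , _ , _ , l) = leaf-off-edge h (rec h≺g) (free ∘ minor-mono (proj₁ ∘ proj₁))
                                              (to-h ab a≢p a≢q) other
                          w≢p = proj₁ (proj₂ (proj₁ (Leaf.wa l)))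
                          w≢q = proj₁ (proj₂ (Leaf.wa l))
                      in w , w≢p , w≢q , mkLeaf g _ _ (_ , proj₁ (proj₁ (Leaf.wa l)))
                           (λ e → Leaf.only l (to-h e w≢p w≢q))
      ; (no no-other) → a , a≢p , a≢q , mkLeaf g b b (b , ab) λ {u} e → inj₁ (case u ≟ b of λ
          { (yes r) → r
          ; (no u≢b) → contradiction (u , edge≢ g e ∘ ≡.sym , u≢b , a , esym h (to-h e a≢p a≢q)) no-other }) }
  where
  h = del (del g p) q
  off : ∀ {u v} → Edge g u v → u ≢ p → u ≢ q → v ≢ p × v ≢ q
  off e u≢p u≢q = (λ { ≡.refl → none (_ , u≢p , u≢q , inj₁ (esym g e)) })
                , (λ { ≡.refl → none (_ , u≢p , u≢q , inj₂ (esym g e)) })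
  to-h : ∀ {u v} → Edge g u v → u ≢ p → u ≢ q → Edge h u v
  to-h e u≢p u≢q = let (v≢p , v≢q) = off e u≢p u≢q in (e , u≢p , v≢p) , u≢q , v≢q
  h≺g : h ≺ g
  h≺g = (λ (u , (e , _) , _) → u , e) , p , (q , pq) , λ (_ , (_ , r , _) , _) → r ≡.refl
... | yes (u , u≢p , u≢q , pu⊎qu) =
  case any? (λ v → ¬? (v ≟ p) ×-dec ¬? (v ≟ u) ×-dec nonIsolated? h v) of λ
      { (no none) → u , u≢p , u≢q , mkLeaf g p q (case pu⊎qu of λ { (inj₁ e) → p , esym g e ; (inj₂ e) → q , esym g e })
          λ {x} e → case ((x ≟ p) , (x ≟ q)) of λ
            { (yes r , _) → inj₁ r
            ; (_ , yes r) → inj₂ r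
            ; (no x≢p , no x≢q) → contradiction
                (x , x≢p , edge≢ g e ∘ ≡.sym , u , edge≢ g e ∘ ≡.sym , x≢q , u≢q , inj₁ (esym g e)) none }
      ; (yes other) → let (w , w≢p , _ , l) = leaf-off-edge h (rec (con-≺ g pq)) (free ∘ minor-con g pq) pu other
                      in go w w≢p l }
  where
  h = con/ g p q
  pu : Edge h p u
  pu = u≢p ∘ ≡.sym , edge≢ g pq , u≢q , [ inj₁ , (λ e → inj₂ (inj₁ (≡.refl , e))) ]′ pu⊎qu

  -- Undoing the contraction changes the neighbours of `w` only by splitting `p` into `p` and `q`,
  -- so the degree grows only if `w` is adjacent to both.
  go : ∀ w → w ≢ p → Leaf h w → ∃ λ w → w ≢ p × w ≢ q × Leaf g w
  go w w≢p (leaf {a} {b} wa wb only) = case (edge? g w q , edge? g w p) of λ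
      { (no ¬wq , _) → w , w≢p , w≢q , mkLeaf g a b ni
          λ e → only (edge≢ g e , w≢q , (λ { ≡.refl → ¬wq e }) , inj₁ e)
      ; (yes wq , no ¬wp) → w , w≢p , w≢q , mkLeaf g (ρ a) (ρ b) (q , wq) λ {x} e → case x ≟ q of λ
          { (yes ≡.refl) → [ (λ { ≡.refl → inj₁ (≡.sym ρp) }) , (λ { ≡.refl → inj₂ (≡.sym ρp) }) ]′ (only (hwp wq))
          ; (no x≢q) → [ (λ { ≡.refl → inj₁ (≡.sym (ρ≢ (λ { ≡.refl → ¬wp e }))) })
                       , (λ { ≡.refl → inj₂ (≡.sym (ρ≢ (λ { ≡.refl → ¬wp e }))) }) ]′
                       (only (edge≢ g e , w≢q , x≢q , inj₁ e)) }
      ; (yes wq , yes wp) → case only (hwp wq) of λ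
          { (inj₁ ≡.refl) → third b wp wq wb only
          ; (inj₂ ≡.refl) → third a wp wq wa (λ e → [ inj₂ , inj₁ ]′ (only e)) } }
    where
    w≢q : w ≢ q
    w≢q = proj₁ (proj₂ wa)
    ni : NonIsolated g w
    ni = proj₁ (con-≺ g pq) (_ , wa)
    hwp : Edge g w q → Edge h w p
    hwp e = w≢p , w≢q , edge≢ g pq , inj₂ (inj₂ (≡.refl , e))
    -- Undoes the contraction at a vertex adjacent to `q` but not to `p`.
    ρ : Fin n → Fin n
    ρ x with x ≟ p
    ... | yes _ = q
    ... | no _  = x
    ρp : ρ p ≡ q
    ρp with p ≟ p
    ... | yes _ = ≡.refl
    ... | no ¬r = contradiction ≡.refl ¬r
    ρ≢ : ∀ {x} → x ≢ p → ρ x ≡ x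
    ρ≢ {x} x≢p with x ≟ p
    ... | yes r = contradiction r x≢p
    ... | no _  = ≡.refl

    third : ∀ r → Edge g w p → Edge g w q → Edge h w r → (∀ {x} → Edge h w x → x ≡ p ⊎ x ≡ r) →
            ∃ λ w → w ≢ p × w ≢ q × Leaf g w
    third r wp wq hwr only = case r ≟ p of λ
        { (yes ≡.refl) → w , w≢p , w≢q , mkLeaf g p q ni λ e →
            case nbrs e of λ { (inj₁ s) → inj₁ s ; (inj₂ (inj₁ s)) → inj₂ s ; (inj₂ (inj₂ s)) → inj₁ s }
        ; (no r≢p) → fourth r≢p (case proj₂ (proj₂ (proj₂ hwr)) of λ
            { (inj₁ e) → e ; (inj₂ (inj₁ (s , _))) → contradiction s w≢p
            ; (inj₂ (inj₂ (s , _))) → contradiction s r≢p }) }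
      where
      r≢q : r ≢ q
      r≢q = proj₁ (proj₂ (proj₂ hwr))
      nbrs : ∀ {x} → Edge g w x → x ≡ p ⊎ x ≡ q ⊎ x ≡ r
      nbrs {x} e = case x ≟ q of λ
        { (yes s) → inj₂ (inj₁ s)
        ; (no x≢q) → [ inj₁ , inj₂ ∘ inj₂ ]′ (only (edge≢ g e , w≢q , x≢q , inj₁ e)) }

      fourth : r ≢ p → Edge g w r → ∃ λ w → w ≢ p × w ≢ q × Leaf g w
      fourth r≢p wr = case leaf-off-edge k (rec (con-≺ g (esym g wr))) (free ∘ minor-con g (esym g wr))
             (edge≢ g pq , w≢p ∘ ≡.sym , w≢q ∘ ≡.sym , inj₁ pq) (r , r≢p , r≢q , p , rp) of λ
        { (t , t≢p , t≢q , l) → case t ≟ r of λ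
          -- All neighbours of `w` are among p, q, r, so `t` is not adjacent to `w` and its edges
          -- survive the contraction unchanged.
          { (no t≢r) → t , t≢p , t≢q , mkLeaf g _ _ (proj₁ (con-≺ g (esym g wr)) (_ , Leaf.wa l))
              λ e → Leaf.only l (edge≢ g e , proj₁ (proj₂ (Leaf.wa l))
                , (λ { ≡.refl → [ t≢p , [ t≢q , t≢r ]′ ]′ (nbrs (esym g e)) }) , inj₁ e)
          ; (yes ≡.refl) → r , r≢p , r≢q , fifth l } }
        where
        k = con/ g r w
        rp : Edge k r p
        rp = r≢p , edge≢ g wr ∘ ≡.sym , w≢p ∘ ≡.sym , inj₂ (inj₁ (≡.refl , wp))
        rq : Edge k r q
        rq = r≢q , edge≢ g wr ∘ ≡.sym , w≢q ∘ ≡.sym , inj₂ (inj₁ (≡.refl , wq))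

        -- In `k` the vertex `r` inherits from `w` the neighbours `p` and `q`, so it has no others.
        -- In `g` it is adjacent to `w` and at most one of them, or p, q, w, r form a K₄.
        fifth : Leaf k r → Leaf g r
        fifth l = case (edge? g r p , edge? g r q) of λ
            { (no ¬rp , _) → mkLeaf g w q (w , esym g wr) λ e → case rnbrs e of λ
                { (inj₁ s) → inj₁ s ; (inj₂ (inj₁ ≡.refl)) → contradiction e ¬rp ; (inj₂ (inj₂ s)) → inj₂ s }
            ; (_ , no ¬rq) → mkLeaf g w p (w , esym g wr) λ e → case rnbrs e of λ
                { (inj₁ s) → inj₁ s ; (inj₂ (inj₁ s)) → inj₂ s ; (inj₂ (inj₂ ≡.refl)) → contradiction e ¬rq }
            ; (yes grp , yes grq) → contradiction (clique-minor g (Vec.lookup (p ∷ q ∷ w ∷ r ∷ []))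
                (clique pq (esym g wp) (esym g grp) (esym g wq) (esym g grq) wr)) free }
          where
          rnbrs : ∀ {x} → Edge g r x → x ≡ w ⊎ x ≡ p ⊎ x ≡ q
          rnbrs {x} e = case x ≟ w of λ
            { (yes s) → inj₁ s
            ; (no x≢w) → inj₂ (case (Leaf.only l rp , Leaf.only l rq ,
                                     Leaf.only l {x} (edge≢ g e , edge≢ g wr ∘ ≡.sym , x≢w , inj₁ e)) of λ
                { (inj₁ ≡.refl , _ , inj₁ s) → inj₁ s
                ; (inj₂ ≡.refl , _ , inj₂ s) → inj₁ s
                ; (_ , inj₁ ≡.refl , inj₁ s) → inj₂ s
                ; (_ , inj₂ ≡.refl , inj₂ s) → inj₂ s
                ; (inj₁ ≡.refl , inj₁ s , inj₂ _) → contradiction (≡.sym s) (edge≢ g pq)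
                ; (inj₂ ≡.refl , inj₂ s , inj₁ _) → contradiction (≡.sym s) (edge≢ g pq) }) }

          clique : ∀ {a b c d} → Edge g a b → Edge g a c → Edge g a d → Edge g b c → Edge g b d → Edge g c d →
                   ∀ {i j} → i ≢ j → Edge g (Vec.lookup (a ∷ b ∷ c ∷ d ∷ []) i) (Vec.lookup (a ∷ b ∷ c ∷ d ∷ []) j)
          clique ab ac ad bc bd cd {zero}               {zero}               i≢j = contradiction ≡.refl i≢j
          clique ab ac ad bc bd cd {zero}               {suc zero}           i≢j = ab
          clique ab ac ad bc bd cd {zero}               {suc (suc zero)}     i≢j = ac
          clique ab ac ad bc bd cd {zero}               {suc (suc (suc zero))} i≢j = ad
          clique ab ac ad bc bd cd {suc zero}           {zero}               i≢j = esym g ab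
          clique ab ac ad bc bd cd {suc zero}           {suc zero}           i≢j = contradiction ≡.refl i≢j
          clique ab ac ad bc bd cd {suc zero}           {suc (suc zero)}     i≢j = bc
          clique ab ac ad bc bd cd {suc zero}           {suc (suc (suc zero))} i≢j = bd
          clique ab ac ad bc bd cd {suc (suc zero)}     {zero}               i≢j = esym g ac
          clique ab ac ad bc bd cd {suc (suc zero)}     {suc zero}           i≢j = esym g bc
          clique ab ac ad bc bd cd {suc (suc zero)}     {suc (suc zero)}     i≢j = contradiction ≡.refl i≢j
          clique ab ac ad bc bd cd {suc (suc zero)}     {suc (suc (suc zero))} i≢j = cd
          clique ab ac ad bc bd cd {suc (suc (suc zero))} {zero}             i≢j = esym g ad
          clique ab ac ad bc bd cd {suc (suc (suc zero))} {suc zero}         i≢j = esym g bd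
          clique ab ac ad bc bd cd {suc (suc (suc zero))} {suc (suc zero)}   i≢j = esym g cd
          clique ab ac ad bc bd cd {suc (suc (suc zero))} {suc (suc (suc zero))} i≢j = contradiction ≡.refl i≢j

leaf-exists : ∀ {n} (g : Gr n) → K₄-free g → ∃ (NonIsolated g) → ∃ (Leaf g)
leaf-exists g free (a , b , ab) = case any? (λ u → ¬? (u ≟ a) ×-dec ¬? (u ≟ b) ×-dec nonIsolated? g u) of λ
  { (yes other) → let (w , _ , _ , l) = leaf-off-edge g (≺-wellFounded g) free ab other in w , l
  ; (no none)   → a , mkLeaf g b b (b , ab) λ {u} e → inj₁ (case u ≟ b of λ
      { (yes r) → r
      ; (no u≢b) → contradiction (u , edge≢ g e ∘ ≡.sym , u≢b , a , esym g e) none }) }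

-- Avoiding an edge at `v` avoids `v`. If no non-isolated vertex lies off that edge, its other end
-- has degree one.
leaf-off-vertex : ∀ {n} (g : Gr n) → K₄-free g → ∀ v → (∃ λ a → a ≢ v × NonIsolated g a) →
                  ∃ λ w → w ≢ v × Leaf g w
leaf-off-vertex g free v (a , a≢v , ni) = case nonIsolated? g v of λ
  { (no ¬ni) → let (w , l) = leaf-exists g free (a , ni) in w , (λ r → ¬ni (subst (NonIsolated g) r (leaf-nonIsolated l))) , l
  ; (yes (q , vq)) → case any? (λ u → ¬? (u ≟ v) ×-dec ¬? (u ≟ q) ×-dec nonIsolated? g u) of λ
      { (yes other) → let (w , w≢v , _ , l) = leaf-off-edge g (≺-wellFounded g) free vq other in w , w≢v , l
      ; (no none)   → q , edge≢ g vq ∘ ≡.sym , mkLeaf g v v (v , esym g vq) λ {u} e → inj₁ (case u ≟ v of λ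
          { (yes r) → r
          ; (no u≢v) → contradiction (u , u≢v , edge≢ g e ∘ ≡.sym , q , esym g e) none }) } }

-- Chains of diamonds and the two exceptions

data Diamonds {n} (g : Gr n) : Fin n → Fin n → Set where
  []  : ∀ {u} → Diamonds g u u
  hop : ∀ {u a b w v} → Edge g u a → Edge g u b → Edge g a b → Edge g w a → Edge g w b →
        Diamonds g w v → Diamonds g u v

module _ {n} {g : Gr n} where
  D-trans : ∀ {u v w} → Diamonds g u v → Diamonds g v w → Diamonds g u w
  D-trans []                 r = r
  D-trans (hop a b c d e p)  r = hop a b c d e (D-trans p r)

  D-sym : ∀ {u v} → Diamonds g u v → Diamonds g v u
  D-sym []                = []
  D-sym (hop a b c d e p) = D-trans (D-sym p) (hop d e c a b [])

D-mono : ∀ {n} {h g : Gr n} {u v} → h ⊑ g → Diamonds h u v → Diamonds g u v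
D-mono i []                = []
D-mono i (hop a b c d e p) = hop (i a) (i b) (i c) (i d) (i e) (D-mono i p)

-- Named after proper 3-colourings: diamonds preserve colours, so the triple gets a single colour in
-- the first configuration and all three in the second.
Monochromatic Rainbow Infeasible : ∀ {n} → Gr n → Fin n → Fin n → Fin n → Set
Monochromatic g x y z = Diamonds g x y × Diamonds g y z
Rainbow g x y z = ∃ λ a → ∃ λ b → ∃ λ c → Edge g a b × Edge g b c × Edge g a c ×
                  Diamonds g x a × Diamonds g y b × Diamonds g z c
Infeasible g x y z = Monochromatic g x y z ⊎ Rainbow g x y z

infeasible-mono : ∀ {n} {h g : Gr n} {x y z} → h ⊑ g → Infeasible h x y z → Infeasible g x y z
infeasible-mono i (inj₁ (p , q)) = inj₁ (D-mono i p , D-mono i q)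
infeasible-mono i (inj₂ (a , b , c , ab , bc , ac , p , q , r)) =
  inj₂ (a , b , c , i ab , i bc , i ac , D-mono i p , D-mono i q , D-mono i r)

infeasible-swap₁₂ : ∀ {n} {g : Gr n} {x y z} → Infeasible g x y z → Infeasible g y x z
infeasible-swap₁₂ (inj₁ (p , q)) = inj₁ (D-sym p , D-trans p q)
infeasible-swap₁₂ {g = g} (inj₂ (a , b , c , ab , bc , ac , p , q , r)) =
  inj₂ (b , a , c , esym g ab , ac , bc , q , p , r)

infeasible-swap₂₃ : ∀ {n} {g : Gr n} {x y z} → Infeasible g x y z → Infeasible g x z y
infeasible-swap₂₃ (inj₁ (p , q)) = inj₁ (D-trans p q , D-sym q)
infeasible-swap₂₃ {g = g} (inj₂ (a , b , c , ab , bc , ac , p , q , r)) =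
  inj₂ (a , c , b , ac , esym g bc , ab , p , r , q)

infeasible-replace : ∀ {n} {g : Gr n} {x x′ y z} → Diamonds g x x′ → Infeasible g x′ y z → Infeasible g x y z
infeasible-replace d (inj₁ (p , q)) = inj₁ (D-trans d p , q)
infeasible-replace d (inj₂ (a , b , c , ab , bc , ac , p , q , r)) =
  inj₂ (a , b , c , ab , bc , ac , D-trans d p , q , r)

del-⊑ : ∀ {n} (g : Gr n) v → del g v ⊑ g
del-⊑ g v = proj₁

K₄-free-del : ∀ {n} (g : Gr n) v → K₄-free g → K₄-free (del g v)
K₄-free-del g v free = free ∘ minor-mono (del-⊑ g v)

leaf-lift : ∀ {n} {h g : Gr n} {w} → h ⊑ g → (∀ {u} → Edge g w u → Edge h w u) → Leaf h w → Leaf g w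
leaf-lift i j (leaf wa wb only) = leaf (i wa) (i wb) (only ∘ j)

leaf-two : ∀ {n} {g : Gr n} {w a b} → Leaf g w → Edge g w a → Edge g w b → a ≢ b →
           ∀ {u} → Edge g w u → u ≡ a ⊎ u ≡ b
leaf-two l wa wb a≢b wu = case (Leaf.only l wa , Leaf.only l wb , Leaf.only l wu) of λ
  { (inj₁ p , inj₁ q , _)      → contradiction (≡.trans p (≡.sym q)) a≢b
  ; (inj₂ p , inj₂ q , _)      → contradiction (≡.trans p (≡.sym q)) a≢b
  ; (inj₁ p , inj₂ q , inj₁ r) → inj₁ (≡.trans r (≡.sym p))
  ; (inj₁ p , inj₂ q , inj₂ r) → inj₂ (≡.trans r (≡.sym q))
  ; (inj₂ p , inj₁ q , inj₁ r) → inj₂ (≡.trans r (≡.sym q))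
  ; (inj₂ p , inj₁ q , inj₂ r) → inj₁ (≡.trans r (≡.sym p)) }

leaf? : ∀ {n} (g : Gr n) w → Dec (Leaf g w)
leaf? g w = map′ (λ (a , b , p , q , f) → leaf p q (λ {u} → f u))
                 (λ (leaf p q f) → _ , _ , p , q , λ u → f {u})
  (any? λ a → any? λ b → edge? g w a ×-dec edge? g w b ×-dec
    all? λ u → edge? g w u →-dec (u ≟ a ⊎-dec u ≟ b))

-- The critical position of a weighted vertex: no diamond leads from `x` to another vertex, so its
-- weight cannot be moved along one.
record Star {n} (g : Gr n) (x p q : Fin n) : Set where
  field
    xp     : Edge g x p
    xq     : Edge g x q
    pq     : Edge g p q
    only   : ∀ {u} → Edge g x u → u ≡ p ⊎ u ≡ q
    unique : ∀ {r} → Edge g r p → Edge g r q → r ≡ x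

module _ {n} {g : Gr n} where
  open Star

  star-leaf : ∀ {x p q} → Star g x p q → Leaf g x
  star-leaf s = leaf (xp s) (xq s) (only s)

  star-swap : ∀ {x p q} → Star g x p q → Star g x q p
  star-swap s = record
    { xp = xq s ; xq = xp s ; pq = esym g (pq s)
    ; only = λ e → [ inj₂ , inj₁ ]′ (only s e) ; unique = λ a b → unique s b a }

  orient : ∀ {x p q u} → Star g x p q → Edge g x u → ∃ (Star g x u)
  orient {p = p} {q} s e = case only s e of λ
    { (inj₁ ≡.refl) → q , s ; (inj₂ ≡.refl) → p , star-swap s }

  star-pq : ∀ {x p q} (s : Star g x p q) → Edge (del g x) p q
  star-pq s = pq s , edge≢ g (xp s) ∘ ≡.sym , edge≢ g (xq s) ∘ ≡.sym

  -- A further neighbour p′ of `p` adjacent to `q` would be a second common neighbour of `p` and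
  -- `q`.
  peel : ∀ {x p q} (s : Star g x p q) → Leaf (del g x) p →
         (∀ u → Edge (del g x) p u → u ≡ q) ⊎
         ∃ λ p′ → q ≢ p′ × Edge (del g x) p p′ × (∀ u → Edge (del g x) p u → u ≡ q ⊎ u ≡ p′)
                × ¬ Edge (del g x) q p′
  peel {x} {p} {q} s l = case any? (λ u → ¬? (q ≟ u) ×-dec edge? (del g x) p u) of λ
    { (no none) → inj₁ λ u e → case q ≟ u of λ
        { (yes r) → ≡.sym r ; (no q≢u) → contradiction (u , q≢u , e) none }
    ; (yes (p′ , q≢p′ , e)) → inj₂ (p′ , q≢p′ , e , (λ u → leaf-two l (star-pq s) e q≢p′)
        , λ (f , _) → proj₂ (proj₂ e) (unique s (esym g (proj₁ e)) (esym g f))) }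

-- Nonvanishing with at most two distinct weighted vertices

module _ {n : ℕ} where
  open Algebra₂ n

  ∼-scale : ∀ {g : Gr n} {f h} m → f ∼ h [ g ] → m * f ∼ m * h [ g ]
  ∼-scale m p = trans (*-assoc m _ _) (trans (*-congˡ p) (sym (*-assoc m _ _)))

  ∼-scaleʳ : ∀ {g : Gr n} {f h} m → f ∼ h [ g ] → f * m ∼ h * m [ g ]
  ∼-scaleʳ {g} m p = trans (*-congʳ (*-comm _ m)) (trans (∼-scale {g} m p) (*-congʳ (*-comm m _)))

  D-∼ : ∀ {g : Gr n} {u v} → Diamonds g u v → var u ∼ var v [ g ]
  D-∼ []                        = refl
  D-∼ {g} (hop ua ub ab wa wb p) = trans (triangle g ua ub ab) (trans (sym (triangle g wa wb ab)) (D-∼ p))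

  -- In a triangle b acts as a + c, so b c acts as a c + c², which is a² by `edge-quadratic`.
  infeasible-∼ : ∀ {g : Gr n} {x y z} → Infeasible g x y z → var y * var z ∼ var x * var x [ g ]
  infeasible-∼ {g} {x} {y} {z} (inj₁ (p , q)) =
    trans (∼-scale {g} (var y) (sym (D-∼ q))) (trans (∼-scale {g} (var y) (sym (D-∼ p)))
      (∼-scaleʳ {g} (var x) (sym (D-∼ p))))
  infeasible-∼ {g} {x} {y} {z} (inj₂ (a , b , c , ab , bc , ac , p , q , r)) = begin
    (var y * var z) * P g               ≈⟨ ∼-scale {g} (var y) (D-∼ r) ⟩
    (var y * var c) * P g               ≈⟨ ∼-scaleʳ {g} (var c) (D-∼ q) ⟩
    (var b * var c) * P g               ≈⟨ ∼-scaleʳ {g} (var c) (triangle g (esym g ab) bc ac) ⟩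
    ((var a + var c) * var c) * P g     ≈⟨ solve 3 (λ a c Q → ((a :+ c) :* c) :* Q :=
                                             (a :* a :+ (a :* c :+ c :* c)) :* Q :+ (a :* a) :* Q)
                                             refl (var a) (var c) (P g) ⟩
    (var a * var a + (var a * var c + var c * var c)) * P g + (var a * var a) * P g
                                        ≈⟨ trans (+-congʳ (edge-quadratic g ac)) (+-identityˡ _) ⟩
    (var a * var a) * P g               ≈⟨ ∼-scale {g} (var a) (sym (D-∼ p)) ⟩
    (var a * var x) * P g               ≈⟨ ∼-scaleʳ {g} (var x) (sym (D-∼ p)) ⟩
    (var x * var x) * P g               ∎
    where open import Relation.Binary.Reasoning.Setoid setoid

  NZ-var² : ∀ (v : Fin n) {f} → Free v f → NZ f → NZ ((var v * var v) * f)
  NZ-var² v {f} p = coefficient₂ v 0# f 0# 0# p (σ-0 {n} v) (σ-0 {n} v)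
    (solve 2 (λ v f → (v :* v) :* f := v :* (v :* (v :* con false)) :+ v :* (v :* f) :+ v :* con false :+ con false)
       refl (var v) f)

  -- Leaves off the edge do not meet the weight and are deleted until `pq` alone remains. There p² q
  -- (p + q) = p² q², since p³ = 0.
  NZ-edge : ∀ (g : Gr n) → Acc _≺_ g → K₄-free g → ∀ {p q} → Edge g p q →
            NZ ((var p * (var p * var q)) * P g)
  NZ-edge g (acc rec) free {p} {q} pq
    with any? (λ a → ¬? (a ≟ p) ×-dec ¬? (a ≟ q) ×-dec nonIsolated? g a)
  ... | yes other = let (w , w≢p , w≢q , l) = leaf-off-edge g (≺-wellFounded g) free pq other in
    NZ-del g _ l (Free-var (w≢p ∘ ≡.sym) F* Free-var (w≢p ∘ ≡.sym) F* Free-var (w≢q ∘ ≡.sym))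
      (NZ-edge (del g w) (rec (del-≺ g (leaf-nonIsolated l))) (K₄-free-del g w free)
        (pq , w≢p ∘ ≡.sym , w≢q ∘ ≡.sym))
  ... | no none = NZ-resp (sym eq) (NZ-resp₂ (NZ-var² p (Free-var (edge≢ g pq ∘ ≡.sym) F* Free-var (edge≢ g pq ∘ ≡.sym))
                    (NZ-resp (*-identityʳ _) (NZ-var² q Free-1 (1≉0 {n})))))
    where
    empty : ∀ u v → ¬ Edge (rem g p q) u v
    empty u v (e , a , b) with u ≟ p | u ≟ q | v ≟ p | v ≟ q
    ... | yes r | _     | _     | yes s = a (r , s)
    ... | _     | yes r | yes s | _     = b (r , s)
    ... | no r  | no s  | _     | _     = none (u , r , s , v , e)
    ... | _     | _     | no r  | no s  = none (v , r , s , u , esym g e)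
    ... | yes r | _     | yes s | _     = edge≢ g e (≡.trans r (≡.sym s))
    ... | _     | yes r | _     | yes s = edge≢ g e (≡.trans r (≡.sym s))
    eq : (var p * (var p * var q)) * P g ≈
         var p * (var p * (var p * var q)) + (var p * var p) * (var q * var q)
    eq = trans (*-congˡ (trans (P-rem g p q pq) (*-congˡ (P-empty (rem g p q) empty))))
      (solve 2 (λ p q → (p :* (p :* q)) :* ((p :+ q) :* con true) :=
        p :* (p :* (p :* q)) :+ (p :* p) :* (q :* q)) refl (var p) (var q))
    NZ-resp₂ : ∀ {f} → NZ f → NZ (var p * (var p * (var p * var q)) + f)
    NZ-resp₂ = NZ-resp (sym (trans (+-congʳ (cube p)) (+-identityˡ _)))

  NZ-P : ∀ (g : Gr n) → K₄-free g → NZ (P g)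
  NZ-P g free with any? (nonIsolated? g)
  ... | yes (p , q , e) = NZ-factor _ (NZ-edge g (≺-wellFounded g) free e)
  ... | no none         = NZ-resp (sym (P-empty g (λ u v e → none (u , v , e)))) (1≉0 {n})

  NZ-square : ∀ (g : Gr n) → K₄-free g → ∀ a → NZ ((var a * var a) * P g)
  NZ-square g free a with nonIsolated? g a
  ... | no ¬ni      = NZ-var² a (Free-P g a (λ u e → ¬ni (u , e))) (NZ-P g free)
  ... | yes (q , e) = NZ-factor (var q) (NZ-resp
    (solve 3 (λ a q Q → (a :* (a :* q)) :* Q := q :* ((a :* a) :* Q)) refl (var a) (var q) (P g))
    (NZ-edge g (≺-wellFounded g) free e))

  -- The contraction is `del g w` with the edge `ab` added. In this way a factor a + b can be
  -- attached without creating a K₄ minor.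
  P-con : ∀ (g : Gr n) {w a b} → Edge g w a → Edge g w b → a ≢ b → ¬ Edge g a b →
          (∀ {u} → Edge g w u → u ≡ a ⊎ u ≡ b) → P (con/ g a w) ≈ (var a + var b) * P (del g w)
  P-con g {w} {a} {b} wa wb a≢b ¬ab only = P-edge (con/ g a w) (del g w) a b
    (a≢b , edge≢ g wa ∘ ≡.sym , edge≢ g wb ∘ ≡.sym , inj₂ (inj₁ (≡.refl , wb)))
    (¬ab ∘ proj₁)
    (λ (e , p , q) → edge≢ g e , p , q , inj₁ e)
    λ { (_ , p , q , inj₁ e) → inj₁ (e , p , q)
      ; (u≢v , p , q , inj₂ (inj₁ (≡.refl , e))) → case only e of λ
          { (inj₁ r) → contradiction (≡.sym r) u≢v ; (inj₂ r) → inj₂ (inj₁ (≡.refl , r)) }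
      ; (u≢v , p , q , inj₂ (inj₂ (≡.refl , e))) → case only (esym g e) of λ
          { (inj₁ r) → contradiction r u≢v ; (inj₂ r) → inj₂ (inj₂ (r , ≡.refl)) } }

  -- Since a³ = 0, a² b² is a² b (a + b), and a + b is the factor of the edge created by contracting
  -- `w`; `NZ-edge` applies to that edge.
  NZ-poles : ∀ (g : Gr n) → K₄-free g → ∀ {w a b} → Edge g w a → Edge g w b → a ≢ b → ¬ Edge g a b →
             (∀ {u} → Edge g w u → u ≡ a ⊎ u ≡ b) → NZ (((var a * var a) * (var b * var b)) * P (del g w))
  NZ-poles g free {w} {a} {b} wa wb a≢b ¬ab only = NZ-resp (trans (*-congˡ (P-con g wa wb a≢b ¬ab only))
      (trans (solve 3 (λ a b Q → (a :* (a :* b)) :* ((a :+ b) :* Q) :=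
          a :* (a :* (a :* (b :* Q))) :+ ((a :* a) :* (b :* b)) :* Q) refl (var a) (var b) (P (del g w)))
        (trans (+-congʳ (cube a)) (+-identityˡ _))))
    (NZ-edge (con/ g a w) (≺-wellFounded _) (free ∘ minor-con g (esym g wa))
      (a≢b , edge≢ g wa ∘ ≡.sym , edge≢ g wb ∘ ≡.sym , inj₂ (inj₁ (≡.refl , wb))))

  -- Here x acts as p + q; the coefficients of p² and p in m (p + q)² (p + p′) are m p′ and m q².
  module _ {g : Gr n} {x p q : Fin n} (s : Star g x p q) (m : ∣Poly∣ n) (mx : Free x m) where
    private
      g₁ = del g x
      H  = del g₁ p
      Q  = P H

      p≢x : p ≢ x
      p≢x = edge≢ g (Star.xp s) ∘ ≡.sym
      q≢x : q ≢ x
      q≢x = edge≢ g (Star.xq s) ∘ ≡.sym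
      q≢p : q ≢ p
      q≢p = edge≢ g (Star.pq s) ∘ ≡.sym

      NZ-first : NZ ((m * (var p + var q)) * P g₁) → NZ ((m * var x) * P g)
      NZ-first nz = NZ-resp (sym (∼-scale {g} m (triangle g (Star.xp s) (Star.xq s) (Star.pq s))))
        (NZ-del g _ (star-leaf s) (mx F* (Free-var p≢x F+ Free-var q≢x)) nz)

    -- One factor p + q replaces x, the other is the edge `pq`; their product p² + q² has
    -- coefficient 1 at p².
    NZ-star₁ : Free p m → (∀ {u} → Edge g₁ p u → u ≡ q) → NZ (m * Q) → NZ ((m * var x) * P g)
    NZ-star₁ mp only nz = NZ-first (coefficient₂ p 0# (m * Q) 0# (m * ((var q * var q) * Q))
      (mp F* fQ) (σ-0 {n} p) (mp F* (fq F* fq) F* fQ)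
      (trans (*-congˡ (P-leaf₁ g₁ p q (star-pq s) only))
        (solve 4 (λ p q m Q → (m :* (p :+ q)) :* ((p :+ q) :* Q) :=
           p :* (p :* (p :* con false)) :+ p :* (p :* (m :* Q)) :+ p :* con false :+ m :* ((q :* q) :* Q))
           refl (var p) (var q) m Q)) nz)
      where
      fQ = Free-del g₁ p
      fq = Free-var q≢p

    NZ-star₂ : Free p m → ∀ {p′} → q ≢ p′ → Edge g₁ p p′ → (∀ {u} → Edge g₁ p u → u ≡ q ⊎ u ≡ p′) →
               NZ ((m * var p′) * Q) ⊎ NZ ((m * (var q * var q)) * Q) → NZ ((m * var x) * P g)
    NZ-star₂ mp {p′} q≢p′ pp′ only nz = NZ-first ([ coefficient₂ p _ _ _ _ fA fB fC eq
                                                  , coefficient₁ p _ _ _ _ fA fB fC eq ]′ nz)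
      where
      fQ = Free-del g₁ p
      fq = Free-var q≢p
      f′ = Free-var (edge≢ g₁ pp′ ∘ ≡.sym)
      fA : Free p ((m * var p′) * Q)
      fA = (mp F* f′) F* fQ
      fB : Free p ((m * (var q * var q)) * Q)
      fB = (mp F* fq F* fq) F* fQ
      fC : Free p ((m * (var q * (var q * var p′))) * Q)
      fC = (mp F* fq F* fq F* f′) F* fQ
      eq : (m * (var p + var q)) * P g₁ ≈
           var p * (var p * (var p * (m * Q))) + var p * (var p * ((m * var p′) * Q))
           + var p * ((m * (var q * var q)) * Q) + (m * (var q * (var q * var p′))) * Q
      eq = trans (*-congˡ (P-leaf₂ g₁ p q p′ q≢p′ (star-pq s) pp′ only))
        (solve 5 (λ p q r m Q → (m :* (p :+ q)) :* ((p :+ q) :* ((p :+ r) :* Q)) :=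
           p :* (p :* (p :* (m :* Q))) :+ p :* (p :* ((m :* r) :* Q))
           :+ p :* ((m :* (q :* q)) :* Q) :+ (m :* (q :* (q :* r))) :* Q)
           refl (var p) (var q) (var p′) m Q)

  module _ {g : Gr n} {x p q : Fin n} (s : Star g x p q) (m : ∣Poly∣ n) (mx : Free x m) (mp : Free p m) where
    private
      g₁ = del g x
      Q  = P (del g₁ p)
      q≢p : q ≢ p
      q≢p = edge≢ g (Star.pq s) ∘ ≡.sym

    -- Here `p` carries weight as well. The p-coefficient of p (p + q)² and the p²-coefficient of p
    -- (p + q)² (p + p′) are both q².
    NZ-star-self : Leaf g₁ p → NZ (((var q * var q) * m) * Q) → NZ (((var p * m) * var x) * P g)
    NZ-star-self l nz = NZ-resp (sym (∼-scale {g} (var p * m) (triangle g (Star.xp s) (Star.xq s) (Star.pq s))))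
      (NZ-del g _ (star-leaf s) ((fpx F* mx) F* (fpx F+ fqx)) (case peel s l of λ
        { (inj₁ only) → coefficient₁ p (m * Q) 0# (((var q * var q) * m) * Q) 0#
            (σ-0 {n} p) (((fq F* fq) F* mp) F* fQ) (σ-0 {n} p)
            (trans (*-congˡ (P-leaf₁ g₁ p q (star-pq s) (only _)))
              (solve 4 (λ p q m Q → ((p :* m) :* (p :+ q)) :* ((p :+ q) :* Q) :=
                 p :* (p :* (p :* (m :* Q))) :+ p :* (p :* con false) :+ p :* (((q :* q) :* m) :* Q) :+ con false)
                 refl (var p) (var q) m Q)) nz
        ; (inj₂ (p′ , q≢p′ , pp′ , only , _)) →
            coefficient₂ p ((var p + var p′) * (m * Q)) (((var q * var q) * m) * Q)
              ((((var q * var q) * m) * var p′) * Q) 0#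
            (((fq F* fq) F* mp) F* fQ)
            ((((fq F* fq) F* mp) F* Free-var (edge≢ g₁ pp′ ∘ ≡.sym)) F* fQ) (σ-0 {n} p)
            (trans (*-congˡ (P-leaf₂ g₁ p q p′ q≢p′ (star-pq s) pp′ (only _)))
              (solve 5 (λ p q r m Q → ((p :* m) :* (p :+ q)) :* ((p :+ q) :* ((p :+ r) :* Q)) :=
                 p :* (p :* (p :* ((p :+ r) :* (m :* Q)))) :+ p :* (p :* (((q :* q) :* m) :* Q))
                 :+ p :* ((((q :* q) :* m) :* r) :* Q) :+ con false)
                 refl (var p) (var q) (var p′) m Q)) nz }))
      where
      fQ  = Free-del g₁ p
      fq  = Free-var q≢p
      fpx = Free-var (edge≢ g (Star.xp s) ∘ ≡.sym)
      fqx = Free-var (edge≢ g (Star.xq s) ∘ ≡.sym)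

  module _ (g : Gr n) {w a b : Fin n} (wa : Edge g w a) (wb : Edge g w b)
           (only : ∀ {u} → Edge g w u → u ≡ a ⊎ u ≡ b) (m : ∣Poly∣ n) (mw : Free w m) where
    private
      Q  = P (del g w)
      fQ = Free-del g w
      fa = Free-var (edge≢ g wa ∘ ≡.sym)
      fb = Free-var (edge≢ g wb ∘ ≡.sym)

    NZ-leaf₁ : a ≡ b → NZ (m * Q) → NZ ((m * var w) * P g)
    NZ-leaf₁ ≡.refl = coefficient₂ w 0# (m * Q) (m * (var a * Q)) 0#
      (mw F* fQ) (mw F* fa F* fQ) (σ-0 {n} w)
      (trans (*-congˡ (P-leaf₁ g w a wa (λ e → [ (λ r → r) , (λ r → r) ]′ (only e))))
        (solve 4 (λ w a m Q → (m :* w) :* ((w :+ a) :* Q) := w :* (w :* (w :* con false)) :+ w :* (w :* (m :* Q))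
          :+ w :* (m :* (a :* Q)) :+ con false) refl (var w) (var a) m Q))

    -- The w²-coefficient of w (w + a) (w + b) is a + b, the edge created by contracting `w`; the
    -- weight at `w` is spent.
    NZ-leaf₂ : a ≢ b → ¬ Edge g a b → NZ (m * P (con/ g a w)) → NZ ((m * var w) * P g)
    NZ-leaf₂ a≢b ¬ab nz = coefficient₂ w (m * Q) (m * ((var a + var b) * Q)) (m * (var a * (var b * Q))) 0#
      (mw F* (fa F+ fb) F* fQ) (mw F* fa F* fb F* fQ) (σ-0 {n} w)
      (trans (*-congˡ (P-leaf₂ g w a b a≢b wa wb only))
        (solve 5 (λ w a b m Q → (m :* w) :* ((w :+ a) :* ((w :+ b) :* Q)) := w :* (w :* (w :* (m :* Q)))
          :+ w :* (w :* (m :* ((a :+ b) :* Q))) :+ w :* (m :* (a :* (b :* Q))) :+ con false)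
          refl (var w) (var a) (var b) m Q))
      (NZ-resp (*-congˡ (P-con g wa wb a≢b ¬ab only)) nz)

  NZ-isolated : ∀ (g : Gr n) w m → ¬ NonIsolated g w → Free w m → NZ (m * P g) → NZ ((m * var w) * P g)
  NZ-isolated g w m iso mw = coefficient₁ w 0# 0# (m * P g) 0#
    (σ-0 {n} w) (mw F* Free-P g w (λ u e → iso (u , e))) (σ-0 {n} w)
    (solve 3 (λ w m Q → (m :* w) :* Q := w :* (w :* (w :* con false)) :+ w :* (w :* con false) :+ w :* (m :* Q) :+ con false)
      refl (var w) m (P g))

  common? : ∀ (g : Gr n) x p q → Dec (∃ λ r → r ≢ x × Edge g r p × Edge g r q)
  common? g x p q = any? λ r → ¬? (r ≟ x) ×-dec edge? g r p ×-dec edge? g r q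

  star : ∀ (g : Gr n) {x p q} → Edge g x p → Edge g x q → Edge g p q →
         (∀ {u} → Edge g x u → u ≡ p ⊎ u ≡ q) → ¬ (∃ λ r → r ≢ x × Edge g r p × Edge g r q) → Star g x p q
  star g {x} xp xq pq only none = record
    { xp = xp ; xq = xq ; pq = pq ; only = only
    ; unique = λ {r} a b → case r ≟ x of λ { (yes e) → e ; (no r≢x) → contradiction (r , r≢x , a , b) none } }

  -- The weight v² forces out-degree 0 at `v`. This is the case of a repeated vertex, on which the
  -- case of three distinct ones relies. The leaf to remove is always taken off `v`.
  NZ-sink : ∀ (g : Gr n) → Acc _≺_ g → K₄-free g → ∀ v z →
            NZ (((var v * var v) * var z) * P g) ⊎ Diamonds g v z
  NZ-sink g (acc rec) free v z with z ≟ v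
  ... | yes ≡.refl = inj₂ []
  ... | no z≢v with nonIsolated? g z
  ...   | no iso = inj₁ (NZ-isolated g z _ iso (Free-var v≢z F* Free-var v≢z) (NZ-square g free v))
    where v≢z = z≢v ∘ ≡.sym
  ...   | yes ni = case leaf-off-vertex g free v (z , z≢v , ni) of λ
      { (u , u≢v , l) → case u ≟ z of λ
        { (no u≢z)     → other u u≢v u≢z l
        ; (yes ≡.refl) → self (Leaf.wa l) (Leaf.wb l) (Leaf.only l) } }
    where
    v≢z : v ≢ z
    v≢z = z≢v ∘ ≡.sym
    g₁ = del g z
    free₁ = K₄-free-del g z free
    fv : Free z (var v * var v)
    fv = Free-var v≢z F* Free-var v≢z

    other : ∀ u → u ≢ v → u ≢ z → Leaf g u → NZ (((var v * var v) * var z) * P g) ⊎ Diamonds g v z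
    other u u≢v u≢z l = case NZ-sink (del g u) (rec (del-≺ g (leaf-nonIsolated l))) (K₄-free-del g u free) v z of λ
      { (inj₁ nz) → inj₁ (NZ-del g _ l ((f F* f) F* Free-var (u≢z ∘ ≡.sym)) nz)
      ; (inj₂ d)  → inj₂ (D-mono (del-⊑ g u) d) }
      where f = Free-var (u≢v ∘ ≡.sym)

    starred : ∀ {p q} → Star g z p q → p ≢ v → Leaf g₁ p → NZ (((var v * var v) * var z) * P g) ⊎ Diamonds g v z
    starred {p} {q} s p≢v l = case peel s l of λ
      { (inj₁ only) → inj₁ (NZ-star₁ s (var v * var v) fv fp (only _)
          (NZ-square (del g₁ p) (K₄-free-del g₁ p free₁) v))
      ; (inj₂ (p′ , q≢p′ , pp′ , only , ¬qp′)) → inj₁ (NZ-star₂ s (var v * var v) fv fp q≢p′ pp′ (only _)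
          (case NZ-sink (del g₁ p) (rec (≺-trans (del g₁ p) g₁ g (del-≺ g₁ (leaf-nonIsolated l)) (del-≺ g ni)))
                        (K₄-free-del g₁ p free₁) v p′ of λ
            { (inj₁ nz) → inj₁ nz
            -- Diamonds join `v` to p′, so v² acts as p′² and the second coefficient becomes p′² q².
            ; (inj₂ d)  → inj₂ (NZ-resp (∼-scaleʳ {del g₁ p} (var q * var q)
                  (trans (∼-scale {del g₁ p} (var p′) (sym (D-∼ d))) (∼-scaleʳ {del g₁ p} (var v) (sym (D-∼ d)))))
                (NZ-poles g₁ free₁ pp′ (star-pq s) (q≢p′ ∘ ≡.sym) (¬qp′ ∘ esym g₁) (λ e → [ inj₂ , inj₁ ]′ (only _ e)))) })) }
      where
      fp : Free p (var v * var v)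
      fp = Free-var (p≢v ∘ ≡.sym) F* Free-var (p≢v ∘ ≡.sym)

    self : ∀ {a b} → Edge g z a → Edge g z b → (∀ {u} → Edge g z u → u ≡ a ⊎ u ≡ b) →
           NZ (((var v * var v) * var z) * P g) ⊎ Diamonds g v z
    self {a} {b} za zb only = case ((a ≟ b) , edge? g a b) of λ
      { (yes a≡b , _) → inj₁ (NZ-leaf₁ g za zb only _ fv a≡b (NZ-square g₁ free₁ v))
      ; (no a≢b , no ¬ab) → inj₁ (NZ-leaf₂ g za zb only _ fv a≢b ¬ab
          (NZ-square (con/ g a z) (free ∘ minor-con g (esym g za)) v))
      ; (no a≢b , yes ab) → case common? g z a b of λ
        { (yes (r , r≢z , ra , rb)) → case NZ-sink g₁ (rec (del-≺ g ni)) free₁ v r of λ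
            { (inj₁ nz) → inj₁ (NZ-resp (∼-scale {g} _ (D-∼ (hop ra rb ab za zb [])))
                (NZ-del g _ (leaf za zb only) (fv F* Free-var r≢z) nz))
            ; (inj₂ d)  → inj₂ (D-trans (D-mono (del-⊑ g z) d) (hop ra rb ab za zb [])) }
        ; (no none) → let s = star g za zb ab only none in
            -- A leaf of `g₁` is either a neighbour of `z`, to be removed right after `z`, or
            -- already a leaf of `g`.
            case leaf-off-vertex g₁ free₁ v (witness a≢b (star-pq s)) of λ
            { (t , t≢v , l) → case ((t ≟ a) , (t ≟ b)) of λ
              { (yes ≡.refl , _) → starred s t≢v l
              ; (_ , yes ≡.refl) → starred (star-swap s) t≢v l
              ; (no t≢a , no t≢b) → other t t≢v (proj₁ (proj₂ (Leaf.wa l)))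
                  (leaf-lift (del-⊑ g z) (λ e → e , proj₁ (proj₂ (Leaf.wa l))
                    , λ { ≡.refl → [ t≢a , t≢b ]′ (only (esym g e)) }) l) } } } }
      where
      witness : a ≢ b → Edge g₁ a b → ∃ λ u → u ≢ v × NonIsolated g₁ u
      witness a≢b e = case a ≟ v of λ
        { (no a≢v) → a , a≢v , b , e
        ; (yes ≡.refl) → b , a≢b ∘ ≡.sym , a , esym g₁ e }

  -- Either a² b is nonzero, and a b divides it, or b acts as a and the weight is a².
  NZ-pair : ∀ (g : Gr n) → K₄-free g → ∀ a b → NZ ((var a * var b) * P g)
  NZ-pair g free a b = case NZ-sink g (≺-wellFounded g) free a b of λ
    { (inj₁ nz) → NZ-factor (var a) (NZ-resp
        (solve 3 (λ a b Q → ((a :* a) :* b) :* Q := a :* ((a :* b) :* Q)) refl (var a) (var b) (P g)) nz)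
    ; (inj₂ d)  → NZ-resp (∼-scale {g} (var a) (D-∼ d)) (NZ-square g free a) }

  -- If this vanished, `edge-quadratic` would make q² z and t² z vanish too, so diamonds would join
  -- `z` to both ends. Then q and t act alike, and q² t acts as q³ = 0, against `NZ-edge`.
  NZ-edge-sum : ∀ (g : Gr n) → K₄-free g → ∀ {q t} → Edge g q t → ∀ z → NZ ((var z * (var q + var t)) * P g)
  NZ-edge-sum g free {q} {t} qt z eq = case (NZ-sink g (≺-wellFounded g) free q z , NZ-sink g (≺-wellFounded g) free t z) of λ
    { (inj₁ nz , _) → nz (trans (swap q) qqz)
    ; (_ , inj₁ nz) → nz (trans (swap t) ttz)
    ; (inj₂ d , inj₂ d′) → NZ-edge g (≺-wellFounded g) free qt (trans
        (trans (*-congʳ (*-congˡ (*-comm _ _)))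
          (trans (∼-scale {g} (var q) (∼-scaleʳ {g} (var q) (trans (D-∼ d′) (sym (D-∼ d)))))
            (solve 2 (λ q Q → (q :* (q :* q)) :* Q := q :* (q :* (q :* Q))) refl (var q) (P g))))
        (cube q)) }
    where
    swap : ∀ v → ((var v * var v) * var z) * P g ≈ var v * (var v * (var z * P g))
    swap v = solve 3 (λ v z Q → ((v :* v) :* z) :* Q := v :* (v :* (z :* Q))) refl (var v) (var z) (P g)
    qqz : var q * (var q * (var z * P g)) ≈ 0#
    qqz = begin
      var q * (var q * (var z * P g))
        ≈⟨ solve 4 (λ q t z Q → q :* (q :* (z :* Q)) :=
             z :* ((q :* q :+ (q :* t :+ t :* t)) :* Q) :+ t :* ((z :* (q :+ t)) :* Q))
             refl (var q) (var t) (var z) (P g) ⟩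
      var z * ((var q * var q + (var q * var t + var t * var t)) * P g) + var t * ((var z * (var q + var t)) * P g)
        ≈⟨ +-cong (trans (*-congˡ (edge-quadratic g qt)) (zeroʳ _)) (trans (*-congˡ eq) (zeroʳ _)) ⟩
      0# + 0# ≈⟨ +-identityˡ 0# ⟩
      0# ∎
      where open import Relation.Binary.Reasoning.Setoid setoid
    ttz : var t * (var t * (var z * P g)) ≈ 0#
    ttz = begin
      var t * (var t * (var z * P g))
        ≈⟨ solve 4 (λ q t z Q → t :* (t :* (z :* Q)) :=
             z :* ((q :* q :+ (q :* t :+ t :* t)) :* Q) :+ q :* ((z :* (q :+ t)) :* Q))
             refl (var q) (var t) (var z) (P g) ⟩
      var z * ((var q * var q + (var q * var t + var t * var t)) * P g) + var q * ((var z * (var q + var t)) * P g)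
        ≈⟨ +-cong (trans (*-congˡ (edge-quadratic g qt)) (zeroʳ _)) (trans (*-congˡ eq) (zeroʳ _)) ⟩
      0# + 0# ≈⟨ +-identityˡ 0# ⟩
      0# ∎
      where open import Relation.Binary.Reasoning.Setoid setoid

  -- Three weights

  Dichotomy : Gr n → Fin n → Fin n → Fin n → Set
  Dichotomy g x y z = NZ ((var x * (var y * var z)) * P g) ⊎ Infeasible g x y z

  dichotomy-swap₁₂ : ∀ {g x y z} → Dichotomy g x y z → Dichotomy g y x z
  dichotomy-swap₁₂ {g} {x} {y} {z} (inj₁ nz) = inj₁ (NZ-resp (*-congʳ
    (solve 3 (λ x y z → x :* (y :* z) := y :* (x :* z)) refl (var x) (var y) (var z))) nz)
  dichotomy-swap₁₂ (inj₂ i) = inj₂ (infeasible-swap₁₂ i)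

  dichotomy-swap₂₃ : ∀ {g x y z} → Dichotomy g x y z → Dichotomy g x z y
  dichotomy-swap₂₃ (inj₁ nz) = inj₁ (NZ-resp (*-congʳ (*-congˡ (*-comm _ _))) nz)
  dichotomy-swap₂₃ (inj₂ i)  = inj₂ (infeasible-swap₂₃ i)

  module Step (g : Gr n) (free : K₄-free g)
              (IH : ∀ (h : Gr n) → h ≺ g → K₄-free h → ∀ a b c → Dichotomy h a b c) where

    delete-leaf : ∀ {x y z u} → Leaf g u → u ≢ x → u ≢ y → u ≢ z → Dichotomy g x y z
    delete-leaf {x} {y} {z} {u} l u≢x u≢y u≢z =
      case IH (del g u) (del-≺ g (leaf-nonIsolated l)) (K₄-free-del g u free) x y z of λ
        { (inj₁ nz) → inj₁ (NZ-del g _ l (f u≢x F* f u≢y F* f u≢z) nz)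
        ; (inj₂ i)  → inj₂ (infeasible-mono (del-⊑ g u) i) }
      where
      f : ∀ {v} → u ≢ v → Free u (var v)
      f p = Free-var (p ∘ ≡.sym)

    nonzero-last : ∀ {x y z} → NZ ((var y * var z * var x) * P g) → Dichotomy g x y z
    nonzero-last nz = inj₁ (NZ-resp (*-congʳ (*-comm _ _)) nz)

    -- A second common neighbour `r` of `a` and `b` forms a diamond with `x`, so the weight moves to
    -- `r` and `x` is deleted. Degree one and nonadjacent neighbours are settled by one coefficient;
    -- only a star is left.
    reduce-leaf : ∀ {x y z} → x ≢ y → x ≢ z → Leaf g x → Dichotomy g x y z ⊎ ∃ λ p → ∃ λ q → Star g x p q
    reduce-leaf {x} {y} {z} x≢y x≢z (leaf {a} {b} xa xb only) = case ((a ≟ b) , edge? g a b) of λ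
        { (yes a≡b , _) → inj₁ (nonzero-last (NZ-leaf₁ g xa xb only _ f a≡b (NZ-pair (del g x) free₁ y z)))
        ; (no a≢b , no ¬ab) → inj₁ (nonzero-last (NZ-leaf₂ g xa xb only _ f a≢b ¬ab
            (NZ-pair (con/ g a x) (free ∘ minor-con g (esym g xa)) y z)))
        ; (no a≢b , yes ab) → case common? g x a b of λ
          { (no none) → inj₂ (a , b , star g xa xb ab only none)
          ; (yes (r , r≢x , ra , rb)) → inj₁ (case IH (del g x) (del-≺ g (a , xa)) free₁ r y z of λ
              { (inj₁ nz) → inj₁ (NZ-resp (∼-scaleʳ {g} _ (D-∼ (hop ra rb ab xa xb [])))
                  (NZ-del g _ (leaf xa xb only) (Free-var r≢x F* f) nz))
              ; (inj₂ i)  → inj₂ (infeasible-replace (hop xa xb ab ra rb []) (infeasible-mono (del-⊑ g x) i)) }) } }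
      where
      free₁ = K₄-free-del g x free
      f : Free x (var y * var z)
      f = Free-var (x≢y ∘ ≡.sym) F* Free-var (x≢z ∘ ≡.sym)

    -- Removing `x` and then `y` leaves the weight q² z. It fails only if diamonds join `z` to `q`,
    -- and then the triangle x, y, q makes the triple rainbow.
    touch-self : ∀ {x y z q} → x ≢ y → x ≢ z → y ≢ z → Star g x y q → Leaf (del g x) y → Dichotomy g x y z
    touch-self {x} {y} {z} {q} x≢y x≢z y≢z s l =
      case NZ-sink H (≺-wellFounded H) (K₄-free-del (del g x) y (K₄-free-del g x free)) q z of λ
        { (inj₁ nz) → nonzero-last (NZ-star-self s (var z) (Free-var (x≢z ∘ ≡.sym)) (Free-var (y≢z ∘ ≡.sym)) l nz)
        ; (inj₂ d)  → inj₂ (inj₂ (x , y , q , Star.xp s , Star.pq s , Star.xq s , [] , []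
            , D-sym (D-mono (proj₁ ∘ proj₁) d))) }
      where H = del (del g x) y

    touch-one : ∀ {x y z p q} → x ≢ y → x ≢ z → y ≢ z → Star g x p q → Leaf (del g x) p → Dichotomy g x y z
    touch-one {x} {y} {z} {p} {q} x≢y x≢z y≢z s l with p ≟ y | p ≟ z
    ... | yes ≡.refl | _          = touch-self x≢y x≢z y≢z s l
    ... | no _       | yes ≡.refl = dichotomy-swap₂₃ (touch-self x≢z x≢y (y≢z ∘ ≡.sym) s l)
    ... | no p≢y     | no p≢z     = nonzero-last (case peel s l of λ
        { (inj₁ only) → NZ-star₁ s _ fx fp (only _) (NZ-pair H freeH y z)
        ; (inj₂ (p′ , q≢p′ , pp′ , only , ¬qp′)) → NZ-star₂ s _ fx fp q≢p′ pp′ (only _)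
            (case IH H (≺-trans H g₁ g (del-≺ g₁ (leaf-nonIsolated l)) (del-≺ g (leaf-nonIsolated (star-leaf s))))
                     freeH p′ y z of λ
              { (inj₁ nz) → inj₁ (NZ-resp (*-congʳ (*-comm _ _)) nz)
              -- With p′, y, z infeasible in `H`, y z acts as p′², and the second coefficient has
              -- weight p′² q².
              ; (inj₂ i)  → inj₂ (NZ-resp (∼-scaleʳ {H} (var q * var q) (sym (infeasible-∼ i)))
                  (NZ-poles g₁ free₁ pp′ (star-pq s) (q≢p′ ∘ ≡.sym) (¬qp′ ∘ esym g₁)
                            (λ e → [ inj₂ , inj₁ ]′ (only _ e)))) }) })
      where
      g₁ = del g x
      H  = del g₁ p
      free₁ = K₄-free-del g x free
      freeH = K₄-free-del g₁ p free₁
      fx : Free x (var y * var z)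
      fx = Free-var (x≢y ∘ ≡.sym) F* Free-var (x≢z ∘ ≡.sym)
      fp : Free p (var y * var z)
      fp = Free-var (p≢y ∘ ≡.sym) F* Free-var (p≢z ∘ ≡.sym)

    -- As x and y act as u + q and u + t, the product is (u² + q²) (u² + t²) z. Its u²-coefficient
    -- is z (q + t)², one factor q + t being the edge created by contracting `u`. If `u` is `z`, the
    -- u-coefficient q² t² is used instead.
    touch-two : ∀ {x y z u q t} → x ≢ y → x ≢ z → y ≢ z → ¬ Edge g x y → Star g x u q → Star g y u t →
                Leaf (del (del g x) y) u → Dichotomy g x y z
    touch-two {x} {y} {z} {u} {q} {t} x≢y x≢z y≢z ¬xy s s′ l = inj₁ (NZ-resp (sym weight)
        (NZ-del g _ (star-leaf s) ((fux F+ fqx) F* (fux F+ ftx) F* Free-var (x≢z ∘ ≡.sym))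
          (NZ-del (del g x) _ y-leaf ((fuy F+ fqy) F* (fuy F+ fty) F* Free-var (y≢z ∘ ≡.sym))
            (case u ≟ z of λ { (no u≢z) → apart u≢z ; (yes ≡.refl) → same }))))
      where
      g₂ = del (del g x) y
      Q  = P (del g₂ u)
      free₂ = K₄-free-del (del g x) y (K₄-free-del g x free)
      u≢x = edge≢ g (Star.xp s) ∘ ≡.sym
      q≢x = edge≢ g (Star.xq s) ∘ ≡.sym
      u≢y = edge≢ g (Star.xp s′) ∘ ≡.sym
      t≢y = edge≢ g (Star.xq s′) ∘ ≡.sym
      q≢y : q ≢ y
      q≢y ≡.refl = ¬xy (Star.xq s)
      t≢x : t ≢ x
      t≢x ≡.refl = ¬xy (esym g (Star.xq s′))
      q≢u = edge≢ g (Star.pq s) ∘ ≡.sym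
      t≢u = edge≢ g (Star.pq s′) ∘ ≡.sym
      fux = Free-var u≢x
      fqx = Free-var q≢x
      ftx = Free-var t≢x
      fuy = Free-var u≢y
      fqy = Free-var q≢y
      fty = Free-var t≢y
      -- Equality of `q` and `t` would make `y` a second common neighbour of `u` and `q`; an edge
      -- `qt` would make `t` one.
      q≢t : q ≢ t
      q≢t ≡.refl = x≢y (≡.sym (Star.unique s (Star.xp s′) (Star.xq s′)))
      uq : Edge g₂ u q
      uq = (Star.pq s , u≢x , q≢x) , u≢y , q≢y
      ut : Edge g₂ u t
      ut = (Star.pq s′ , u≢x , t≢x) , u≢y , t≢y
      ¬qt : ¬ Edge g₂ q t
      ¬qt ((e , _) , _) = t≢x (Star.unique s (esym g (Star.pq s′)) (esym g e))
      only : ∀ {v} → Edge g₂ u v → v ≡ q ⊎ v ≡ t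
      only = leaf-two l uq ut q≢t
      y-leaf : Leaf (del g x) y
      y-leaf = leaf (Star.xp s′ , x≢y ∘ ≡.sym , u≢x) (Star.xq s′ , x≢y ∘ ≡.sym , t≢x) (λ (e , _) → Star.only s′ e)
      W = (var u + var q) * ((var u + var t) * var z)
      weight : (var x * (var y * var z)) * P g ≈ W * P g
      weight = trans (∼-scaleʳ {g} _ (triangle g (Star.xp s) (Star.xq s) (Star.pq s)))
        (∼-scale {g} _ (∼-scaleʳ {g} _ (triangle g (Star.xp s′) (Star.xq s′) (Star.pq s′))))
      expand : W * P g₂ ≈ W * ((var u + var q) * ((var u + var t) * Q))
      expand = *-congˡ (P-leaf₂ g₂ u q t q≢t uq ut only)
      fQ = Free-del g₂ u
      fq = Free-var q≢u
      ft = Free-var t≢u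

      apart : u ≢ z → NZ (W * P g₂)
      apart u≢z = coefficient₂ u (var u * (var z * Q)) ((var z * (var q + var t)) * ((var q + var t) * Q)) 0#
          ((var q * var q) * ((var t * var t) * (var z * Q)))
          ((fz F* (fq F+ ft)) F* (fq F+ ft) F* fQ) (σ-0 {n} u) ((fq F* fq) F* (ft F* ft) F* fz F* fQ)
          (trans expand (solve 5 (λ u q t z Q → ((u :+ q) :* ((u :+ t) :* z)) :* ((u :+ q) :* ((u :+ t) :* Q)) :=
             u :* (u :* (u :* (u :* (z :* Q)))) :+ u :* (u :* ((z :* (q :+ t)) :* ((q :+ t) :* Q)))
             :+ u :* con false :+ (q :* q) :* ((t :* t) :* (z :* Q)))
             refl (var u) (var q) (var t) (var z) Q))
          (NZ-resp (*-congˡ (P-con g₂ uq ut q≢t ¬qt only))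
            (NZ-edge-sum (con/ g₂ q u) (free₂ ∘ minor-con g₂ (esym g₂ uq))
              (q≢t , q≢u , t≢u , inj₂ (inj₁ (≡.refl , ut))) z))
        where
        fz = Free-var (u≢z ∘ ≡.sym)

      same : NZ (((var u + var q) * ((var u + var t) * var u)) * P g₂)
      same = coefficient₁ u ((var u * var u + (var q * var q + var t * var t)) * Q) 0#
          (((var q * var q) * (var t * var t)) * Q) 0#
          (σ-0 {n} u) (((fq F* fq) F* (ft F* ft)) F* fQ) (σ-0 {n} u)
          (trans (*-congˡ (P-leaf₂ g₂ u q t q≢t uq ut only))
            (solve 4 (λ u q t Q → ((u :+ q) :* ((u :+ t) :* u)) :* ((u :+ q) :* ((u :+ t) :* Q)) :=
             u :* (u :* (u :* ((u :* u :+ (q :* q :+ t :* t)) :* Q))) :+ u :* (u :* con false)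
             :+ u :* (((q :* q) :* (t :* t)) :* Q) :+ con false)
             refl (var u) (var q) (var t) Q))
          (NZ-poles g₂ free₂ uq ut q≢t ¬qt only)

    -- What `reduce-leaf` leaves open for a weighted vertex: a star, or degree zero or at least
    -- three.
    Status : Fin n → Set
    Status x = (∃ λ p → ∃ λ q → Star g x p q) ⊎ ¬ Leaf g x

    lift₁ : ∀ {a u} → ¬ Edge g u a → Leaf (del g a) u → Leaf g u
    lift₁ {a} ¬ua l = leaf-lift (del-⊑ g a)
      (λ e → e , proj₁ (proj₂ (Leaf.wa l)) , λ { ≡.refl → ¬ua e }) l

    touched : ∀ {x y z p q u} → x ≢ y → x ≢ z → y ≢ z → Star g x p q → Edge g u x → Leaf (del g x) u → Dichotomy g x y z
    touched x≢y x≢z y≢z s ux l = touch-one x≢y x≢z y≢z (proj₂ (orient s (esym g ux))) l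

    -- Without `x`, the vertex `y` has a single neighbour and is itself a leaf touching `x`.
    adjacent : ∀ {x y z p q s t} → x ≢ y → x ≢ z → y ≢ z → Star g x p q → Star g y s t → Edge g x y → Dichotomy g x y z
    adjacent {x} {y} x≢y x≢z y≢z s s′ xy = case orient s′ (esym g xy) of λ
      { (r , s″) → touched x≢y x≢z y≢z s (esym g xy) (mkLeaf (del g x) _ _
          (r , Star.xq s″ , x≢y ∘ ≡.sym , edge≢ g (Star.pq s″) ∘ ≡.sym) (λ (e , _) → Star.only s″ e)) }

    -- For one, two or three stars alike: the stars are removed, and a leaf `u` of the rest is
    -- classified by the stars adjacent to it. If there are none, `u` is a leaf of `g` without
    -- weight.
    case₁ : ∀ {x y z p q} → x ≢ y → x ≢ z → y ≢ z → Star g x p q → ¬ Leaf g y → ¬ Leaf g z → Dichotomy g x y z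
    case₁ {x} {p = p} x≢y x≢z y≢z s ¬y ¬z with leaf-exists (del g x) (K₄-free-del g x free) (p , _ , star-pq s)
    ... | u , l with edge? g u x
    ...   | yes ux = touched x≢y x≢z y≢z s ux l
    ...   | no ¬ux = delete-leaf l′ (proj₁ (proj₂ (Leaf.wa l))) (λ { ≡.refl → ¬y l′ }) (λ { ≡.refl → ¬z l′ })
      where l′ = lift₁ ¬ux l

    off-star : ∀ {x y p q} → Star g x p q → ¬ Edge g x y → p ≢ y × q ≢ y
    off-star s ¬xy = (λ { ≡.refl → ¬xy (Star.xp s) }) , (λ { ≡.refl → ¬xy (Star.xq s) })

    case₂ : ∀ {x y z p q s t} → x ≢ y → x ≢ z → y ≢ z → Star g x p q → Star g y s t → ¬ Leaf g z → Dichotomy g x y z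
    case₂ {x} {y} {z} {p} x≢y x≢z y≢z s s′ ¬z with edge? g x y
    ... | yes xy = adjacent x≢y x≢z y≢z s s′ xy
    ... | no ¬xy with leaf-exists (del (del g x) y) (K₄-free-del (del g x) y (K₄-free-del g x free))
                      (p , _ , star-pq s , off-star s ¬xy)
    ...   | u , l with edge? g u x | edge? g u y
    ...     | no ¬ux | no ¬uy = delete-leaf l′ u≢x u≢y (λ { ≡.refl → ¬z l′ })
      where
      u≢x = proj₁ (proj₂ (proj₁ (Leaf.wa l)))
      u≢y = proj₁ (proj₂ (Leaf.wa l))
      l′ = lift₁ ¬ux (leaf-lift proj₁ (λ e → e , u≢y , λ { ≡.refl → ¬uy (proj₁ e) }) l)
    ...     | yes ux | no ¬uy = touched x≢y x≢z y≢z s ux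
      (leaf-lift proj₁ (λ e → e , proj₁ (proj₂ (Leaf.wa l)) , λ { ≡.refl → ¬uy (proj₁ e) }) l)
    ...     | no ¬ux | yes uy = dichotomy-swap₁₂ (touched (x≢y ∘ ≡.sym) y≢z x≢z s′ uy
      (leaf-lift (λ ((e , _) , r) → e , r)
        (λ (e , r) → (e , proj₁ (proj₂ (proj₁ (Leaf.wa l))) , λ { ≡.refl → ¬ux e }) , r) l))
    ...     | yes ux | yes uy = touch-two x≢y x≢z y≢z ¬xy
      (proj₂ (orient s (esym g ux))) (proj₂ (orient s′ (esym g uy))) l

    case₃ : ∀ {x y z p q s t a b} → x ≢ y → x ≢ z → y ≢ z → Star g x p q → Star g y s t → Star g z a b → Dichotomy g x y z
    case₃ {x} {y} {z} {p} x≢y x≢z y≢z s s′ s″ with edge? g x y | edge? g x z | edge? g y z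
    ... | yes xy | _      | _      = adjacent x≢y x≢z y≢z s s′ xy
    ... | no _   | yes xz | _      = dichotomy-swap₂₃ (adjacent x≢z x≢y (y≢z ∘ ≡.sym) s s″ xz)
    ... | no _   | no _   | yes yz =
      dichotomy-swap₁₂ (dichotomy-swap₂₃ (adjacent y≢z (x≢y ∘ ≡.sym) (x≢z ∘ ≡.sym) s′ s″ yz))
    ... | no ¬xy | no ¬xz | no ¬yz with leaf-exists (del (del (del g x) y) z)
          (K₄-free-del (del (del g x) y) z (K₄-free-del (del g x) y (K₄-free-del g x free)))
          (p , _ , (star-pq s , off-star s ¬xy) , off-star s ¬xz)
    ...   | u , l = go (edge? g u x) (edge? g u y) (edge? g u z)
      where
      u≢x = proj₁ (proj₂ (proj₁ (proj₁ (Leaf.wa l))))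
      u≢y = proj₁ (proj₂ (proj₁ (Leaf.wa l)))
      u≢z = proj₁ (proj₂ (Leaf.wa l))
      off : ∀ {a} → u ≢ a → ¬ Edge g u a → ∀ {v} → Edge g u v → u ≢ a × v ≢ a
      off u≢a ¬ua e = u≢a , λ { ≡.refl → ¬ua e }

      go : Dec (Edge g u x) → Dec (Edge g u y) → Dec (Edge g u z) → Dichotomy g x y z
      go (no ¬ux) (no ¬uy) (no ¬uz) = delete-leaf (leaf-lift (λ (((e , _) , _) , _) → e)
        (λ e → ((e , off u≢x ¬ux e) , off u≢y ¬uy e) , off u≢z ¬uz e) l) u≢x u≢y u≢z
      go (yes ux) (no ¬uy) (no ¬uz) = touched x≢y x≢z y≢z s ux
        (leaf-lift (λ ((e , _) , _) → e) (λ f@(e , _) → (f , off u≢y ¬uy e) , off u≢z ¬uz e) l)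
      go (no ¬ux) (yes uy) (no ¬uz) = dichotomy-swap₁₂ (touched (x≢y ∘ ≡.sym) y≢z x≢z s′ uy
        (leaf-lift (λ (((e , _) , r) , _) → e , r) (λ (e , r) → ((e , off u≢x ¬ux e) , r) , off u≢z ¬uz e) l))
      go (no ¬ux) (no ¬uy) (yes uz) = dichotomy-swap₂₃ (dichotomy-swap₁₂ (touched (x≢z ∘ ≡.sym) (y≢z ∘ ≡.sym) x≢y s″ uz
        (leaf-lift (λ (((e , _) , _) , r) → e , r) (λ (e , r) → ((e , off u≢x ¬ux e) , off u≢y ¬uy e) , r) l)))
      go (yes ux) (yes uy) (no ¬uz) = touch-two x≢y x≢z y≢z ¬xy
        (proj₂ (orient s (esym g ux))) (proj₂ (orient s′ (esym g uy)))
        (leaf-lift (λ (e , _) → e) (λ f@((e , _) , _) → f , off u≢z ¬uz e) l)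
      go (yes ux) (no ¬uy) (yes uz) = dichotomy-swap₂₃ (touch-two x≢z x≢y (y≢z ∘ ≡.sym) ¬xz
        (proj₂ (orient s (esym g ux))) (proj₂ (orient s″ (esym g uz)))
        (leaf-lift (λ ((e , _) , r) → e , r) (λ (f@(e , _) , r) → (f , off u≢y ¬uy e) , r) l))
      go (no ¬ux) (yes uy) (yes uz) = dichotomy-swap₁₂ (dichotomy-swap₂₃ (touch-two y≢z (x≢y ∘ ≡.sym) (x≢z ∘ ≡.sym) ¬yz
        (proj₂ (orient s′ (esym g uy))) (proj₂ (orient s″ (esym g uz)))
        (leaf-lift (λ (((e , _) , r) , r′) → (e , r) , r′) (λ ((e , r) , r′) → ((e , off u≢x ¬ux e) , r) , r′) l)))
      go (yes ux) (yes uy) (yes uz) with orient s (esym g ux) | orient s′ (esym g uy) | orient s″ (esym g uz)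
      ... | q , t | q′ , t′ | q″ , t″ =
          -- The third vertices of the three triangles at `u` are distinct, since the edge opposite
          -- a star lies in no other triangle. So `u` keeps three neighbours and cannot be a leaf.
          case (leaf-two l (edge t (off-star t ¬xy) (off-star t ¬xz) (star-off t))
                           (edge t′ (star-off t′) (off-star t′ ¬yz) (off-star t′ (¬xy ∘ esym g))) distinct
                           (edge t″ (off-star t″ (¬yz ∘ esym g)) (star-off t″) (off-star t″ (¬xz ∘ esym g)))) of λ
            { (inj₁ ≡.refl) → contradiction (Star.unique t (Star.xp t″) (Star.xq t″)) (x≢z ∘ ≡.sym)
            ; (inj₂ ≡.refl) → contradiction (Star.unique t′ (Star.xp t″) (Star.xq t″)) (y≢z ∘ ≡.sym) }
        where
        star-off : ∀ {a b} → Star g a u b → u ≢ a × b ≢ a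
        star-off t = edge≢ g (Star.xp t) ∘ ≡.sym , edge≢ g (Star.xq t) ∘ ≡.sym
        edge : ∀ {a b} → Star g a u b → u ≢ y × b ≢ y → u ≢ z × b ≢ z → u ≢ x × b ≢ x →
               Edge (del (del (del g x) y) z) u b
        edge t r r′ r″ = ((Star.pq t , r″) , r) , r′
        distinct : q ≢ q′
        distinct ≡.refl = x≢y (≡.sym (Star.unique t (Star.xp t′) (Star.xq t′)))

    distinct-case : ∀ {x y z} → x ≢ y → x ≢ z → y ≢ z → Dichotomy g x y z
    distinct-case {x} {y} {z} x≢y x≢z y≢z with nonIsolated? g x
    ... | no iso = nonzero-last (NZ-isolated g x _ iso
          (Free-var (x≢y ∘ ≡.sym) F* Free-var (x≢z ∘ ≡.sym)) (NZ-pair g free y z))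
    ... | yes ni = case (status x≢y x≢z , status (x≢y ∘ ≡.sym) y≢z , status (x≢z ∘ ≡.sym) (y≢z ∘ ≡.sym)) of λ
        { (inj₁ r , _ , _) → r
        ; (inj₂ _ , inj₁ r , _) → dichotomy-swap₁₂ r
        ; (inj₂ _ , inj₂ _ , inj₁ r) → dichotomy-swap₂₃ (dichotomy-swap₁₂ r)
        ; (inj₂ sx , inj₂ sy , inj₂ sz) → by-status sx sy sz }
      where
      status : ∀ {x y z} → x ≢ y → x ≢ z → Dichotomy g x y z ⊎ Status x
      status {x} x≢y x≢z = case leaf? g x of λ
        { (no ¬l) → inj₂ (inj₂ ¬l)
        ; (yes l) → [ inj₁ , (λ s → inj₂ (inj₁ s)) ]′ (reduce-leaf x≢y x≢z l) }
      y≢x = x≢y ∘ ≡.sym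
      z≢x = x≢z ∘ ≡.sym
      z≢y = y≢z ∘ ≡.sym

      by-status : Status x → Status y → Status z → Dichotomy g x y z
      by-status (inj₁ (_ , _ , s)) (inj₁ (_ , _ , s′)) (inj₁ (_ , _ , s″)) = case₃ x≢y x≢z y≢z s s′ s″
      by-status (inj₁ (_ , _ , s)) (inj₁ (_ , _ , s′)) (inj₂ ¬z) = case₂ x≢y x≢z y≢z s s′ ¬z
      by-status (inj₁ (_ , _ , s)) (inj₂ ¬y) (inj₁ (_ , _ , s″)) = dichotomy-swap₂₃ (case₂ x≢z x≢y z≢y s s″ ¬y)
      by-status (inj₁ (_ , _ , s)) (inj₂ ¬y) (inj₂ ¬z) = case₁ x≢y x≢z y≢z s ¬y ¬z
      by-status (inj₂ ¬x) (inj₁ (_ , _ , s′)) (inj₁ (_ , _ , s″)) =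
        dichotomy-swap₁₂ (dichotomy-swap₂₃ (case₂ y≢z y≢x z≢x s′ s″ ¬x))
      by-status (inj₂ ¬x) (inj₁ (_ , _ , s′)) (inj₂ ¬z) = dichotomy-swap₁₂ (case₁ y≢x y≢z x≢z s′ ¬x ¬z)
      by-status (inj₂ ¬x) (inj₂ ¬y) (inj₁ (_ , _ , s″)) =
        dichotomy-swap₂₃ (dichotomy-swap₁₂ (case₁ z≢x z≢y x≢y s″ ¬x ¬y))
      by-status (inj₂ ¬x) (inj₂ ¬y) (inj₂ ¬z) with leaf-exists g free (x , ni)
      ... | u , l = delete-leaf l (λ { ≡.refl → ¬x l }) (λ { ≡.refl → ¬y l }) (λ { ≡.refl → ¬z l })

    repeated : ∀ x z → Dichotomy g x x z
    repeated x z = case NZ-sink g (≺-wellFounded g) free x z of λ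
      { (inj₁ nz) → inj₁ (NZ-resp (*-congʳ (*-assoc _ _ _)) nz)
      ; (inj₂ d)  → inj₂ (inj₁ ([] , d)) }

    -- Repetitions must be included: a substitute vertex `r` or `p′` may coincide with another
    -- member of the triple.
    every-case : ∀ x y z → Dichotomy g x y z
    every-case x y z with x ≟ y | x ≟ z | y ≟ z
    ... | yes ≡.refl | _          | _          = repeated x z
    ... | no _       | yes ≡.refl | _          = dichotomy-swap₂₃ (repeated x y)
    ... | no _       | no _       | yes ≡.refl = dichotomy-swap₂₃ (dichotomy-swap₁₂ (dichotomy-swap₂₃ (repeated y x)))
    ... | no x≢y     | no x≢z     | no y≢z     = distinct-case x≢y x≢z y≢z

  dichotomy : ∀ (g : Gr n) → Acc _≺_ g → K₄-free g → ∀ x y z → Dichotomy g x y z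
  dichotomy g (acc rec) free = Step.every-case g free (λ h h≺g → dichotomy h (rec h≺g))

-- Coefficients of monomials

-- The default `false` reflects that monomials with an exponent above 2 vanish in the ring.
select : ℕ → Bool → Bool → Bool → Bool
select 0 a b c = a
select 1 a b c = b
select 2 a b c = c
select (suc (suc (suc _))) a b c = false

coeff : ∀ {n} → ∣Poly∣ n → (Fin n → ℕ) → Bool
coeff {zero}  b           m = b
coeff {suc n} (a , b , c) m = select (m zero) (coeff a (m ∘ suc)) (coeff b (m ∘ suc)) (coeff c (m ∘ suc))

-- The exponents after division by `v`. At exponent 0 nothing changes, so `coeff-var` and `lower-δ`
-- assume a positive exponent.
lower : ∀ {n} → Fin n → (Fin n → ℕ) → Fin n → ℕ
lower zero    m zero    = pred (m zero)
lower zero    m (suc u) = m (suc u)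
lower (suc v) m zero    = m zero
lower (suc v) m (suc u) = lower v (m ∘ suc) u

coeff-cong : ∀ {n} {f g : ∣Poly∣ n} (m : Fin n → ℕ) → M._≈_ n f g → coeff {n} f m ≡ coeff {n} g m
coeff-cong {zero}  m p = p
coeff-cong {suc n} m (p , q , r)
  rewrite coeff-cong {n} (m ∘ suc) p | coeff-cong {n} (m ∘ suc) q | coeff-cong {n} (m ∘ suc) r = ≡.refl

coeff-ext : ∀ {k} (f : ∣Poly∣ k) {m m′} → (∀ v → m v ≡ m′ v) → coeff {k} f m ≡ coeff {k} f m′
coeff-ext {zero}  f p = ≡.refl
coeff-ext {suc k} (a , b , c) p
  rewrite p zero | coeff-ext {k} a (p ∘ suc) | coeff-ext {k} b (p ∘ suc) | coeff-ext {k} c (p ∘ suc) = ≡.refl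

coeff-0 : ∀ {n} (m : Fin n → ℕ) → coeff {n} (M.0# n) m ≡ false
coeff-0 {zero}  m = ≡.refl
coeff-0 {suc n} m rewrite coeff-0 {n} (m ∘ suc) with m zero
... | 0 = ≡.refl
... | 1 = ≡.refl
... | 2 = ≡.refl
... | suc (suc (suc _)) = ≡.refl

coeff-+ : ∀ {n} (f g : ∣Poly∣ n) m → coeff {n} (M._+_ n f g) m ≡ coeff {n} f m xor coeff {n} g m
coeff-+ {zero}  f g m = ≡.refl
coeff-+ {suc n} (a , b , c) (d , e , f) m
  rewrite coeff-+ {n} a d (m ∘ suc) | coeff-+ {n} b e (m ∘ suc) | coeff-+ {n} c f (m ∘ suc) with m zero
... | 0 = ≡.refl
... | 1 = ≡.refl
... | 2 = ≡.refl
... | suc (suc (suc _)) = ≡.refl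

coeff-1⁺ : ∀ {n} (m : Fin n → ℕ) → (∀ v → m v ≡ 0) → coeff {n} (M.1# n) m ≡ true
coeff-1⁺ {zero}  m p = ≡.refl
coeff-1⁺ {suc n} m p rewrite p zero = coeff-1⁺ {n} (m ∘ suc) (p ∘ suc)

coeff-1⁻ : ∀ {n} (m : Fin n → ℕ) → coeff {n} (M.1# n) m ≡ true → ∀ v → m v ≡ 0
coeff-1⁻ {suc n} m p v with m zero in eq | coeff-0 {n} (m ∘ suc)
coeff-1⁻ {suc n} m p zero    | 0 | _ = eq
coeff-1⁻ {suc n} m p (suc v) | 0 | _ = coeff-1⁻ {n} (m ∘ suc) p v
coeff-1⁻ {suc n} m p v       | 1 | q = case ≡.trans (≡.sym q) p of λ ()
coeff-1⁻ {suc n} m p v       | 2 | q = case ≡.trans (≡.sym q) p of λ ()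

coeff-bound : ∀ {n} (f : ∣Poly∣ n) m → coeff {n} f m ≡ true → ∀ v → m v ≤ 2
coeff-bound {suc n} (a , b , c) m p v with m zero in eq
coeff-bound {suc n} (a , b , c) m p zero | 0 = subst (_≤ 2) (≡.sym eq) z≤n
coeff-bound {suc n} (a , b , c) m p zero | 1 = subst (_≤ 2) (≡.sym eq) (s≤s z≤n)
coeff-bound {suc n} (a , b , c) m p zero | 2 = subst (_≤ 2) (≡.sym eq) (s≤s (s≤s z≤n))
coeff-bound {suc n} (a , b , c) m p (suc v) | 0 = coeff-bound {n} a (m ∘ suc) p v
coeff-bound {suc n} (a , b , c) m p (suc v) | 1 = coeff-bound {n} b (m ∘ suc) p v
coeff-bound {suc n} (a , b , c) m p (suc v) | 2 = coeff-bound {n} c (m ∘ suc) p v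

nonzero-coeff : ∀ {n} (f : ∣Poly∣ n) → M._≈_ n f (M.0# n) ⊎ ∃ λ m → coeff {n} f m ≡ true
nonzero-coeff {zero}  false = inj₁ ≡.refl
nonzero-coeff {zero}  true  = inj₂ ((λ ()) , ≡.refl)
nonzero-coeff {suc n} (a , b , c) with nonzero-coeff {n} a | nonzero-coeff {n} b | nonzero-coeff {n} c
... | inj₁ p | inj₁ q | inj₁ r = inj₁ (p , q , r)
... | inj₂ (m , p) | _ | _ = inj₂ ((λ { zero → 0 ; (suc v) → m v }) , p)
... | _ | inj₂ (m , p) | _ = inj₂ ((λ { zero → 1 ; (suc v) → m v }) , p)
... | _ | _ | inj₂ (m , p) = inj₂ ((λ { zero → 2 ; (suc v) → m v }) , p)

module _ {n : ℕ} where
  open import Algebra.Solver.Ring.NaturalCoefficients.Default (Poly n) using (solve; _:+_; _:*_; _:=_; con)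

  var-zero-* : ∀ (a b c : ∣Poly∣ n) → M._≈_ (suc n) (M._*_ (suc n) (var {suc n} zero) (a , b , c)) (M.0# n , a , b)
  var-zero-* a b c =
      M.zeroˡ n a
    , solve 2 (λ a b → con 0 :* b :+ con 1 :* a := a) (M.refl n) a b
    , solve 3 (λ a b c → con 0 :* c :+ con 1 :* b :+ con 0 :* a := b) (M.refl n) a b c

  var-suc-* : ∀ (v : Fin n) (a b c : ∣Poly∣ n) → M._≈_ (suc n) (M._*_ (suc n) (var (suc v)) (a , b , c))
              (M._*_ n (var v) a , M._*_ n (var v) b , M._*_ n (var v) c)
  var-suc-* v a b c =
      M.refl n
    , solve 3 (λ x a b → x :* b :+ con 0 :* a := x :* b) (M.refl n) (var v) a b
    , solve 4 (λ x a b c → x :* c :+ con 0 :* b :+ con 0 :* a := x :* c) (M.refl n) (var v) a b c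

coeff-var-0 : ∀ {n} (v : Fin n) f m → m v ≡ 0 → coeff {n} (M._*_ n (var v) f) m ≡ false
coeff-var-0 {suc n} zero (a , b , c) m p =
  ≡.trans (coeff-cong {suc n} m (var-zero-* {n} a b c)) (≡.trans
    (cong (λ k → select k (coeff {n} (M.0# n) (m ∘ suc)) (coeff {n} a (m ∘ suc)) (coeff {n} b (m ∘ suc))) p)
    (coeff-0 {n} (m ∘ suc)))
coeff-var-0 {suc n} (suc v) (a , b , c) m p = ≡.trans (coeff-cong {suc n} m (var-suc-* {n} v a b c)) go
  where
  go : coeff {suc n} (M._*_ n (var v) a , M._*_ n (var v) b , M._*_ n (var v) c) m ≡ false
  go rewrite coeff-var-0 {n} v a (m ∘ suc) p | coeff-var-0 {n} v b (m ∘ suc) p | coeff-var-0 {n} v c (m ∘ suc) p with m zero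
  ... | 0 = ≡.refl
  ... | 1 = ≡.refl
  ... | 2 = ≡.refl
  ... | suc (suc (suc _)) = ≡.refl

coeff-var : ∀ {n} (v : Fin n) f m → 1 ≤ m v → m v ≤ 2 → coeff {n} (M._*_ n (var v) f) m ≡ coeff {n} f (lower v m)
coeff-var {suc n} zero (a , b , c) m p q = ≡.trans (coeff-cong {suc n} m (var-zero-* {n} a b c)) (go (m zero) p q)
  where
  go : ∀ k → 1 ≤ k → k ≤ 2 → select k (coeff {n} (M.0# n) (m ∘ suc)) (coeff {n} a (m ∘ suc)) (coeff {n} b (m ∘ suc))
       ≡ select (pred k) (coeff {n} a (m ∘ suc)) (coeff {n} b (m ∘ suc)) (coeff {n} c (m ∘ suc))
  go 1 _ _ = ≡.refl
  go 2 _ _ = ≡.refl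
  go (suc (suc (suc _))) _ (s≤s (s≤s ()))
coeff-var {suc n} (suc v) (a , b , c) m p q = ≡.trans (coeff-cong {suc n} m (var-suc-* {n} v a b c)) go
  where
  go : coeff {suc n} (M._*_ n (var v) a , M._*_ n (var v) b , M._*_ n (var v) c) m
       ≡ coeff {suc n} (a , b , c) (lower (suc v) m)
  go rewrite coeff-var {n} v a (m ∘ suc) p q | coeff-var {n} v b (m ∘ suc) p q | coeff-var {n} v c (m ∘ suc) p q = ≡.refl

coeff-var⁻ : ∀ {n} (v : Fin n) f m → coeff {n} (M._*_ n (var v) f) m ≡ true →
             1 ≤ m v × coeff {n} f (lower v m) ≡ true
coeff-var⁻ {n} v f m p with m v in eq
... | zero  = case ≡.trans (≡.sym p) (coeff-var-0 {n} v f m eq) of λ ()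
... | suc _ = s≤s z≤n , ≡.trans (≡.sym (coeff-var {n} v f m (subst (1 ≤_) (≡.sym eq) (s≤s z≤n))
                                        (coeff-bound {n} _ m p v))) p

lower-≤ : ∀ {n} (v : Fin n) m u → lower v m u ≤ m u
lower-≤ zero    m zero    = ℕₚ.pred[n]≤n
lower-≤ zero    m (suc u) = ≤-refl
lower-≤ (suc v) m zero    = ≤-refl
lower-≤ (suc v) m (suc u) = lower-≤ v (m ∘ suc) u

lower-self : ∀ {n} (v : Fin n) m → lower v m v ≡ pred (m v)
lower-self zero    m = ≡.refl
lower-self (suc v) m = lower-self v (m ∘ suc)

δ : ∀ {n} → Fin n → Fin n → ℕ
δ u v = if eqF u v then 1 else 0

lower-δ : ∀ {n} (v : Fin n) m → 1 ≤ m v → ∀ u → m u ≡ δ v u ℕ.+ lower v m u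
lower-δ zero    m p zero with m zero | p
... | suc _ | _ = ≡.refl
lower-δ zero    m p (suc u) = ≡.refl
lower-δ (suc v) m p zero    = ≡.refl
lower-δ (suc v) m p (suc u) = lower-δ v (m ∘ suc) p u

δ-self : ∀ {n} (v : Fin n) → δ v v ≡ 1
δ-self v rewrite dec-true (v ≟ v) ≡.refl = ≡.refl

-- Coefficients as counts of sub-digraphs modulo 2

Arcs : ℕ → Set
Arcs n = List (Fin n × Fin n)

outdegIn-∷ : ∀ {n} (u w v : Fin n) F → outdegIn ((u , w) ∷ F) v ≡ δ u v ℕ.+ outdegIn F v
outdegIn-∷ u w v F with eqF u v
... | true  = ≡.refl
... | false = ≡.refl

indegIn-∷ : ∀ {n} (u w v : Fin n) F → indegIn ((u , w) ∷ F) v ≡ δ w v ℕ.+ indegIn F v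
indegIn-∷ u w v F with eqF w v
... | true  = ≡.refl
... | false = ≡.refl

≡-true : ∀ {a b : Bool} → (a ≡ true → b ≡ true) → (b ≡ true → a ≡ true) → a ≡ b
≡-true {true}  {true}  p q = ≡.refl
≡-true {false} {false} p q = ≡.refl
≡-true {true}  {false} p q = ≡.sym (p ≡.refl)
≡-true {false} {true}  p q = q ≡.refl

≢-true : ∀ {a : Bool} → a ≢ true → a ≡ false
≢-true {true}  p = contradiction ≡.refl p
≢-true {false} p = ≡.refl

allB⁺ : ∀ {A : Set} (p : A → Bool) xs → (∀ x → p x ≡ true) → allB p xs ≡ true
allB⁺ p []       f = ≡.refl
allB⁺ p (x ∷ xs) f rewrite f x = allB⁺ p xs f

allB⁻ : ∀ {A : Set} (p : A → Bool) {x xs} → allB p xs ≡ true → x ∈ xs → p x ≡ true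
allB⁻ p {xs = y ∷ xs} q (here ≡.refl) with p y
... | true = ≡.refl
allB⁻ p {xs = y ∷ xs} q (there i) with p y
... | true = allB⁻ p q i

≡ᵇ⁺ : ∀ {a b} → a ≡ b → (a ≡ᵇ b) ≡ true
≡ᵇ⁺ {a} {b} p = Equivalence.to T-≡ (≡⇒≡ᵇ a b p)

≡ᵇ⁻ : ∀ {a b} → (a ≡ᵇ b) ≡ true → a ≡ b
≡ᵇ⁻ {a} {b} p = ≡ᵇ⇒≡ a b (Equivalence.from T-≡ p)

module _ {n : ℕ} where
  -- The sub-digraph S of L is reversed: the monomial obtained by taking the heads of the arcs in S
  -- and the tails of the other arcs of L is x^m.
  Balanced : Arcs n → Arcs n → (Fin n → ℕ) → Set
  Balanced S L m = ∀ v → indegIn S v ℕ.+ outdegIn L v ≡ m v ℕ.+ outdegIn S v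

  balanced : Arcs n → Arcs n → (Fin n → ℕ) → Bool
  balanced S L m = allB (λ v → (indegIn S v ℕ.+ outdegIn L v) ≡ᵇ (m v ℕ.+ outdegIn S v)) (allFin n)

  balanced⁺ : ∀ S L m → Balanced S L m → balanced S L m ≡ true
  balanced⁺ S L m b = allB⁺ _ (allFin n) (λ v → ≡ᵇ⁺ (b v))

  balanced⁻ : ∀ S L m → balanced S L m ≡ true → Balanced S L m
  balanced⁻ S L m b v = ≡ᵇ⁻ (allB⁻ _ b (∈-allFin v))

  balanced-cong : ∀ S L m S′ L′ m′ → (Balanced S L m → Balanced S′ L′ m′) → (Balanced S′ L′ m′ → Balanced S L m) →
                  balanced S L m ≡ balanced S′ L′ m′
  balanced-cong S L m S′ L′ m′ f g = ≡-true (balanced⁺ S′ L′ m′ ∘ f ∘ balanced⁻ S L m)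
                                            (balanced⁺ S L m ∘ g ∘ balanced⁻ S′ L′ m′)

  parity : List Bool → Bool
  parity = foldr _xor_ false

  parity-++ : ∀ xs ys → parity (xs ++ ys) ≡ parity xs xor parity ys
  parity-++ []       ys = ≡.refl
  parity-++ (x ∷ xs) ys = ≡.trans (cong (x xor_) (parity-++ xs ys)) (≡.sym (xor-assoc x _ _))

  parity-cong : ∀ {A : Set} {f g : A → Bool} {xs} → All (λ x → f x ≡ g x) xs → parity (map f xs) ≡ parity (map g xs)
  parity-cong []       = ≡.refl
  parity-cong (p ∷ ps) = cong₂ _xor_ p (parity-cong ps)

  parity-false : ∀ {A : Set} {f : A → Bool} {xs} → All (λ x → f x ≡ false) xs → parity (map f xs) ≡ false
  parity-false []       = ≡.refl
  parity-false (p ∷ ps) rewrite p = parity-false ps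

  subsets-outdegIn : ∀ (L : Arcs n) → All (λ S → ∀ v → outdegIn S v ≤ outdegIn L v) (subsets L)
  subsets-outdegIn []            = (λ v → z≤n) ∷ []
  subsets-outdegIn ((u , w) ∷ L) = Allₚ.++⁺
    (All.map (λ {S} p v → ≤-trans (p v) (subst (outdegIn L v ≤_) (≡.sym (outdegIn-∷ u w v L)) (ℕₚ.m≤n+m _ (δ u v))))
      (subsets-outdegIn L))
    (Allₚ.map⁺ (All.map (λ {S} p v → ≡.subst₂ _≤_ (≡.sym (outdegIn-∷ u w v S)) (≡.sym (outdegIn-∷ u w v L))
      (ℕₚ.+-monoʳ-≤ (δ u v) (p v))) (subsets-outdegIn L)))

  pair : Fin n × Fin n → ∣Poly∣ n
  pair (u , w) = M._+_ n (var u) (var w)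

  module _ (u w : Fin n) (L S : Arcs n) (m : Fin n → ℕ) where
    open +-*-Solver
    private
      e = (u , w)

    -- An arc outside `S` contributes its tail and, in `take-head`, an arc of `S` its head; dividing
    -- the monomial by that vertex disposes of the arc.
    keep-tail : 1 ≤ m u → balanced S (e ∷ L) m ≡ balanced S L (lower u m)
    keep-tail p = balanced-cong S (e ∷ L) m S L (lower u m)
      (λ b v → +-cancelˡ-≡ (δ u v) _ _ (≡.trans (≡.sym (lhs v)) (≡.trans (b v) (rhs v))))
      (λ b v → ≡.trans (lhs v) (≡.trans (cong (δ u v ℕ.+_) (b v)) (≡.sym (rhs v))))
      where
      lhs : ∀ v → indegIn S v ℕ.+ outdegIn (e ∷ L) v ≡ δ u v ℕ.+ (indegIn S v ℕ.+ outdegIn L v)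
      lhs v = ≡.trans (cong (indegIn S v ℕ.+_) (outdegIn-∷ u w v L))
        (solve 3 (λ i d o → i :+ (d :+ o) := d :+ (i :+ o)) ≡.refl (indegIn S v) (δ u v) (outdegIn L v))
      rhs : ∀ v → m v ℕ.+ outdegIn S v ≡ δ u v ℕ.+ (lower u m v ℕ.+ outdegIn S v)
      rhs v = ≡.trans (cong (ℕ._+ outdegIn S v) (lower-δ u m p v)) (ℕₚ.+-assoc (δ u v) _ _)

    take-head : 1 ≤ m w → balanced (e ∷ S) (e ∷ L) m ≡ balanced S L (lower w m)
    take-head p = balanced-cong (e ∷ S) (e ∷ L) m S L (lower w m)
      (λ b v → +-cancelˡ-≡ (δ w v ℕ.+ δ u v) _ _ (≡.trans (≡.sym (lhs v)) (≡.trans (b v) (rhs v))))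
      (λ b v → ≡.trans (lhs v) (≡.trans (cong ((δ w v ℕ.+ δ u v) ℕ.+_) (b v)) (≡.sym (rhs v))))
      where
      lhs : ∀ v → indegIn (e ∷ S) v ℕ.+ outdegIn (e ∷ L) v ≡ (δ w v ℕ.+ δ u v) ℕ.+ (indegIn S v ℕ.+ outdegIn L v)
      lhs v = ≡.trans (cong₂ ℕ._+_ (indegIn-∷ u w v S) (outdegIn-∷ u w v L))
        (solve 4 (λ d i c o → (d :+ i) :+ (c :+ o) := (d :+ c) :+ (i :+ o)) ≡.refl (δ w v) (indegIn S v) (δ u v) (outdegIn L v))
      rhs : ∀ v → m v ℕ.+ outdegIn (e ∷ S) v ≡ (δ w v ℕ.+ δ u v) ℕ.+ (lower w m v ℕ.+ outdegIn S v)
      rhs v = ≡.trans (cong₂ ℕ._+_ (lower-δ w m p v) (outdegIn-∷ u w v S))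
        (solve 4 (λ d l c o → (d :+ l) :+ (c :+ o) := (d :+ c) :+ (l :+ o)) ≡.refl (δ w v) (lower w m v) (δ u v) (outdegIn S v))

    module _ (sub : ∀ v → outdegIn S v ≤ outdegIn L v) where
      -- At exponent 0, balance would give `S` more arcs out of `u` than `L` has.
      no-tail : m u ≡ 0 → balanced S (e ∷ L) m ≡ false
      no-tail p = ≢-true λ b → 1+n≰n {outdegIn S u} (≤-trans (s≤s (sub u)) (≤-trans
        (ℕₚ.m≤n+m _ (indegIn S u)) (ℕₚ.≤-reflexive (≡.trans
          (cong (indegIn S u ℕ.+_) (≡.sym (≡.trans (outdegIn-∷ u w u L) (cong (ℕ._+ outdegIn L u) (δ-self u)))))
          (≡.trans (balanced⁻ S (e ∷ L) m b u) (cong (ℕ._+ outdegIn S u) p))))))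

      no-head : m w ≡ 0 → balanced (e ∷ S) (e ∷ L) m ≡ false
      no-head p = ≢-true λ b → 1+n≰n {outdegIn (e ∷ S) w} (≤-trans
        (s≤s (≡.subst₂ _≤_ (≡.sym (outdegIn-∷ u w w S)) (≡.sym (outdegIn-∷ u w w L)) (ℕₚ.+-monoʳ-≤ (δ u w) (sub w))))
        (≤-trans (s≤s (ℕₚ.m≤n+m _ (indegIn S w))) (ℕₚ.≤-reflexive (≡.trans
          (cong (ℕ._+ outdegIn (e ∷ L) w) (≡.sym (≡.trans (indegIn-∷ u w w S) (cong (ℕ._+ indegIn S w) (δ-self w)))))
          (≡.trans (balanced⁻ (e ∷ S) (e ∷ L) m b w) (cong (ℕ._+ outdegIn (e ∷ S) w) p))))))

  -- Expanding the product picks one end of each arc, and `S` records the arcs whose head is picked.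
  -- The bound on `m` excludes monomials that truncation kills although choices for them exist.
  coeff-parity : ∀ (L : Arcs n) m → (∀ v → m v ≤ 2) →
                 coeff {n} (∏ {n} pair L) m ≡ parity (map (λ S → balanced S L m) (subsets L))
  coeff-parity [] m ≤2 = ≡.trans
    (≡-true (λ p → balanced⁺ [] [] m λ v → ≡.sym (≡.trans (ℕₚ.+-identityʳ _) (coeff-1⁻ {n} m p v)))
            (λ p → coeff-1⁺ {n} m λ v → ≡.trans (≡.sym (ℕₚ.+-identityʳ _)) (≡.sym (balanced⁻ [] [] m p v))))
    (≡.sym (xor-identityʳ _))
  coeff-parity (e@(u , w) ∷ L) m ≤2 = begin
    coeff {n} (M._*_ n (pair e) f) m
      ≡⟨ coeff-cong {n} m (M.distribʳ n f (var u) (var w)) ⟩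
    coeff {n} (M._+_ n (M._*_ n (var u) f) (M._*_ n (var w) f)) m
      ≡⟨ coeff-+ {n} _ _ m ⟩
    coeff {n} (M._*_ n (var u) f) m xor coeff {n} (M._*_ n (var w) f) m
      ≡⟨ cong₂ _xor_ tails heads ⟩
    parity (map b (subsets L)) xor parity (map b (map (e ∷_) (subsets L)))
      ≡⟨ ≡.sym (parity-++ (map b (subsets L)) _) ⟩
    parity (map b (subsets L) ++ map b (map (e ∷_) (subsets L)))
      ≡⟨ cong parity (≡.sym (map-++ b (subsets L) _)) ⟩
    parity (map b (subsets (e ∷ L))) ∎
    where
    open ≡.≡-Reasoning
    f = ∏ {n} pair L
    b : Arcs n → Bool
    b S = balanced S (e ∷ L) m
    lower-≤2 : ∀ v u → lower v m u ≤ 2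
    lower-≤2 v u = ≤-trans (lower-≤ v m u) (≤2 u)
    tails : coeff {n} (M._*_ n (var u) f) m ≡ parity (map b (subsets L))
    tails with m u in eq
    ... | zero = ≡.trans (coeff-var-0 {n} u f m eq)
      (≡.sym (parity-false (All.map (λ {S} p → no-tail u w L S m p eq) (subsets-outdegIn L))))
    ... | suc _ = ≡.trans (coeff-var {n} u f m 1≤ (≤2 u)) (≡.trans (coeff-parity L (lower u m) (lower-≤2 u))
      (parity-cong (All.universal (λ S → ≡.sym (keep-tail u w L S m 1≤)) (subsets L))))
      where
      1≤ : 1 ≤ m u
      1≤ = subst (1 ≤_) (≡.sym eq) (s≤s z≤n)
    heads : coeff {n} (M._*_ n (var w) f) m ≡ parity (map b (map (e ∷_) (subsets L)))
    heads with m w in eq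
    ... | zero = ≡.trans (coeff-var-0 {n} w f m eq)
      (≡.sym (≡.trans (cong parity (≡.sym (map-∘ (subsets L))))
        (parity-false (All.map (λ {S} p → no-head u w L S m p eq) (subsets-outdegIn L)))))
    ... | suc _ = ≡.trans (coeff-var {n} w f m 1≤ (≤2 w)) (≡.trans (coeff-parity L (lower w m) (lower-≤2 w))
      (≡.trans (parity-cong (All.universal (λ S → ≡.sym (take-head u w L S m 1≤)) (subsets L)))
        (cong parity (map-∘ (subsets L)))))
      where
      1≤ : 1 ≤ m w
      1≤ = subst (1 ≤_) (≡.sym eq) (s≤s z≤n)

  -- Reversing `S` preserves all out-degrees exactly when `S` is Eulerian.
  balanced-eulerian : ∀ (S L : Arcs n) → balanced S L (outdegIn L) ≡ isEulerian S
  balanced-eulerian S L = ≡-true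
    (λ p → allB⁺ _ (allFin n) λ v → ≡ᵇ⁺ (+-cancelˡ-≡ (outdegIn L v) _ _
      (≡.trans (≡.sym (balanced⁻ S L _ p v)) (ℕₚ.+-comm (indegIn S v) _))))
    (λ p → balanced⁺ S L _ λ v → ≡.trans (ℕₚ.+-comm (indegIn S v) _)
      (cong (outdegIn L v ℕ.+_) (≡.sym (≡ᵇ⁻ (allB⁻ _ p (∈-allFin v))))))

-- Parity of integers

Parity : ℤ → Bool → Set
Parity z b = ∃ λ k → z ≡ (k ℤ.+ k) ℤ.+ (if b then + 1 else + 0)

parity-+ : ∀ {y z a b} → Parity y a → Parity z b → Parity (y ℤ.+ z) (a xor b)
parity-+ {a = true}  {true}  (k , ≡.refl) (l , ≡.refl) = k ℤ.+ l ℤ.+ + 1 ,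
  solve 2 (λ k l → ((k :+ k) :+ con (+ 1)) :+ ((l :+ l) :+ con (+ 1))
    := ((k :+ l :+ con (+ 1)) :+ (k :+ l :+ con (+ 1))) :+ con (+ 0)) ≡.refl k l
  where open ℤSolver.+-*-Solver
parity-+ {a = true}  {false} (k , ≡.refl) (l , ≡.refl) = k ℤ.+ l ,
  solve 2 (λ k l → ((k :+ k) :+ con (+ 1)) :+ ((l :+ l) :+ con (+ 0))
    := ((k :+ l) :+ (k :+ l)) :+ con (+ 1)) ≡.refl k l
  where open ℤSolver.+-*-Solver
parity-+ {a = false} {b} (k , ≡.refl) (l , ≡.refl) = k ℤ.+ l ,
  solve 3 (λ k l c → ((k :+ k) :+ con (+ 0)) :+ ((l :+ l) :+ c)
    := ((k :+ l) :+ (k :+ l)) :+ c) ≡.refl k l (if b then + 1 else + 0)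
  where open ℤSolver.+-*-Solver

-- Both 1 and -1 are odd, so the number of arcs of an Eulerian sub-digraph is irrelevant modulo 2.
parity-sign : ∀ b d → Parity (if b then (if d then + 1 else ℤ.- (+ 1)) else + 0) b
parity-sign true  true  = + 0 , ≡.refl
parity-sign true  false = ℤ.- (+ 1) , ≡.refl
parity-sign false _     = + 0 , ≡.refl

parity-sum : ∀ {A : Set} (c : A → ℤ) (b : A → Bool) → (∀ a → Parity (c a) (b a)) → ∀ as →
             Parity (foldr ℤ._+_ (+ 0) (map c as)) (foldr _xor_ false (map b as))
parity-sum c b p []       = + 0 , ≡.refl
parity-sum c b p (a ∷ as) = parity-+ (p a) (parity-sum c b p as)

odd≢0 : ∀ {z} → Parity z true → z ≢ + 0
odd≢0 (+ k , p) q with () ← ≡.trans (cong ℤ.∣_∣ (≡.trans (≡.sym q) p)) (ℕₚ.+-comm (k ℕ.+ k) 1)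
odd≢0 (-[1+ k ] , p) q with () ← ≡.trans (≡.sym q) p

-- From a monomial to an orientation

↭-unique : ∀ {A : Set} {xs ys : List A} → Unique xs → Unique ys →
           (∀ {a} → a ∈ xs → a ∈ ys) → (∀ {a} → a ∈ ys → a ∈ xs) → xs ↭ ys
↭-unique p q f g = ∼bag⇒↭ (unique∧set⇒bag p q (mk⇔ f g))

∈-filterᵇ⁺ : ∀ {A : Set} (p : A → Bool) {a as} → a ∈ as → p a ≡ true → a ∈ filterᵇ p as
∈-filterᵇ⁺ p i q = ∈-filter⁺ (T? ∘ p) i (Equivalence.from T-≡ q)

∈-filterᵇ⁻ : ∀ {A : Set} (p : A → Bool) {a as} → a ∈ filterᵇ p as → a ∈ as × p a ≡ true
∈-filterᵇ⁻ p i = map₂ (Equivalence.to T-≡) (∈-filter⁻ (T? ∘ p) i)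

distinct-images : ∀ {A B : Set} {f : A → B} {as} → Unique (map f as) →
                  ∀ {a b} → a ∈ as → b ∈ as → f a ≡ f b → a ≡ b
distinct-images u        (here ≡.refl) (here ≡.refl) _ = ≡.refl
distinct-images (p ∷ _)  (here ≡.refl) (there j)     q = contradiction q (All.lookup p (∈-map⁺ _ j))
distinct-images (p ∷ _)  (there i)     (here ≡.refl) q = contradiction (≡.sym q) (All.lookup p (∈-map⁺ _ i))
distinct-images (_ ∷ u)  (there i)     (there j)     q = distinct-images u i j q

eqF-true : ∀ {n} {u v : Fin n} → eqF u v ≡ true → u ≡ v
eqF-true {u = u} {v} p with u ≟ v
... | yes q = q

module _ {n : ℕ} where
  open Algebra₂ n using () renaming
    ( refl to ≈-refl; sym to ≈-sym; trans to ≈-trans; reflexive to ≈-reflexive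
    ; *-cong to ≈-*-cong; *-congˡ to ≈-*-congˡ; *-identityˡ to ≈-*-identityˡ )

  edges : Gr n → Arcs n
  edges g = filter (edge<? g) (allPairs n)

  opaque
    unfolding P
    P-edges : ∀ (g : Gr n) → M._≈_ n (P g) (∏ {n} pair (edges g))
    P-edges g = go (allPairs n)
      where
      go : ∀ es → M._≈_ n (∏ {n} (factor g) es) (∏ {n} pair (filter (edge<? g) es))
      go []       = ≈-refl
      go (e@(u , v) ∷ es) = case edge<? g e of λ
        { (yes p) → ≈-trans (≈-*-cong (≈-reflexive (factor-yes g u v p)) (go es))
                      (≈-reflexive (cong (∏ {n} pair) (≡.sym (filter-accept (edge<? g) p))))
        ; (no ¬p) → ≈-trans (≈-*-cong (≈-reflexive (factor-no g e ¬p)) (go es)) (≈-trans (≈-*-identityˡ _)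
                      (≈-reflexive (cong (∏ {n} pair) (≡.sym (filter-reject (edge<? g) ¬p))))) }

  -- Forgets the direction of an arc: the underlying edge is its increasing pair, as in `edges`.
  sort : Fin n × Fin n → Fin n × Fin n
  sort (u , v) = if does (u Finₚ.<? v) then (u , v) else (v , u)

  sort-< : ∀ {u v} → u Fin.< v → sort (u , v) ≡ (u , v)
  sort-< {u} {v} p rewrite dec-true (u Finₚ.<? v) p = ≡.refl

  sort-≮ : ∀ {u v} → ¬ u Fin.< v → sort (u , v) ≡ (v , u)
  sort-≮ {u} {v} p rewrite dec-false (u Finₚ.<? v) p = ≡.refl

  sort-> : ∀ {u v} → v Fin.< u → sort (u , v) ≡ (v , u)
  sort-> p = sort-≮ (λ q → Finₚ.<-asym p q)

  sort-cases : ∀ u v → sort (u , v) ≡ (u , v) ⊎ sort (u , v) ≡ (v , u)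
  sort-cases u v = case u Finₚ.<? v of λ { (yes p) → inj₁ (sort-< p) ; (no ¬p) → inj₂ (sort-≮ ¬p) }

  sort-swap : ∀ {u v} → u ≢ v → sort (u , v) ≡ sort (v , u)
  sort-swap {u} {v} u≢v with Finₚ.<-cmp u v
  ... | tri< p _ _ = ≡.trans (sort-< p) (≡.sym (sort-> p))
  ... | tri≈ _ p _ = contradiction p u≢v
  ... | tri> _ _ p = ≡.trans (sort-> p) (≡.sym (sort-< p))

  sort-injective : ∀ {u v a b} → sort (a , b) ≡ sort (u , v) → (a ≡ u × b ≡ v) ⊎ (a ≡ v × b ≡ u)
  sort-injective {u} {v} {a} {b} p with sort-cases a b | sort-cases u v
  ... | inj₁ q | inj₁ r = case ≡.trans (≡.sym q) (≡.trans p r) of λ { ≡.refl → inj₁ (≡.refl , ≡.refl) }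
  ... | inj₁ q | inj₂ r = case ≡.trans (≡.sym q) (≡.trans p r) of λ { ≡.refl → inj₂ (≡.refl , ≡.refl) }
  ... | inj₂ q | inj₁ r = case ≡.trans (≡.sym q) (≡.trans p r) of λ { ≡.refl → inj₂ (≡.refl , ≡.refl) }
  ... | inj₂ q | inj₂ r = case ≡.trans (≡.sym q) (≡.trans p r) of λ { ≡.refl → inj₁ (≡.refl , ≡.refl) }

  pair-sort : ∀ (es : Arcs n) → M._≈_ n (∏ {n} pair es) (∏ {n} pair (map sort es))
  pair-sort []             = ≈-refl
  pair-sort ((u , v) ∷ es) = ≈-*-cong (case sort-cases u v of λ
    { (inj₁ p) → ≈-reflexive (cong pair (≡.sym p))
    ; (inj₂ p) → ≈-trans (M.+-comm n _ _) (≈-reflexive (cong pair (≡.sym p))) }) (pair-sort es)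

  ∏-↭ : ∀ {xs ys : Arcs n} → xs ↭ ys → M._≈_ n (∏ {n} pair xs) (∏ {n} pair ys)
  ∏-↭ ↭.refl          = ≈-refl
  ∏-↭ (↭.prep x p)    = ≈-*-congˡ (∏-↭ p)
  ∏-↭ (↭.swap x y p)  = ≈-trans (≈-*-congˡ (≈-*-congˡ (∏-↭ p)))
    (≈-trans (≈-sym (M.*-assoc n _ _ _)) (≈-trans (M.*-congʳ n (M.*-comm n _ _)) (M.*-assoc n _ _ _)))
  ∏-↭ (↭.trans p q)   = ≈-trans (∏-↭ p) (∏-↭ q)

  -- A coefficient 1 of (u + w) f comes from u f or from w f; the vertex that supplies it becomes
  -- the tail of the edge.
  orient-edges : ∀ (es : Arcs n) m → All (λ (u , v) → u Fin.< v) es → coeff {n} (∏ {n} pair es) m ≡ true →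
                 ∃ λ es′ → map sort es′ ≡ es × (∀ v → outdegIn es′ v ≡ m v)
  orient-edges [] m [] p = [] , ≡.refl , λ v → ≡.sym (coeff-1⁻ {n} m p v)
  orient-edges ((u , w) ∷ es) m (u<w ∷ <s) p with coeff {n} (M._*_ n (var u) f) m in eq₁ | coeff {n} (M._*_ n (var w) f) m in eq₂
    where f = ∏ {n} pair es
  ... | true | _ =
    let (m≥1 , q)        = coeff-var⁻ {n} u (∏ {n} pair es) m eq₁
        (es′ , r , outs) = orient-edges es (lower u m) <s q
    in (u , w) ∷ es′ , cong₂ _∷_ (sort-< u<w) r
       , λ v → ≡.trans (outdegIn-∷ u w v es′) (≡.trans (cong (δ u v ℕ.+_) (outs v)) (≡.sym (lower-δ u m m≥1 v)))
  ... | false | true =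
    let (m≥1 , q)        = coeff-var⁻ {n} w (∏ {n} pair es) m eq₂
        (es′ , r , outs) = orient-edges es (lower w m) <s q
    in (w , u) ∷ es′ , cong₂ _∷_ (sort-> u<w) r
       , λ v → ≡.trans (outdegIn-∷ w u v es′) (≡.trans (cong (δ w v ℕ.+_) (outs v)) (≡.sym (lower-δ w m m≥1 v)))
  ... | false | false = case ≡.trans (≡.sym p)
      (≡.trans (coeff-cong {n} m (M.distribʳ n f (var u) (var w)))
        (≡.trans (coeff-+ {n} (M._*_ n (var u) f) (M._*_ n (var w) f) m) (cong₂ _xor_ eq₁ eq₂))) of λ ()
    where f = ∏ {n} pair es

-- Return to the given graph

fromGraph : (G : Graph) → Gr (Graph.n G)
fromGraph G = record
  { Edge  = Adj G
  ; edge? = λ u v → Graph.adj G u v Bool.≟ true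
  ; esym  = λ {u} {v} e → ≡.trans (Graph.sym G v u) e
  ; eirr  = λ {v} e → case ≡.trans (≡.sym (Graph.irrefl G v)) e of λ ()
  }

fromGraph-free : ∀ G → K4MinorFree G → K₄-free (fromGraph G)
fromGraph-free G free (b , ne , con , adj) = free (b , ne , (λ i u v p q → walk (con i u v p q)) , adj)
  where
  walk : ∀ {Q u v} → Walk (fromGraph G) Q u v → WalkIn G Q u v
  walk here         = WalkIn.here
  walk (step e q w) = WalkIn.step e q (walk w)

module _ (G : Graph) where
  private
    n = Graph.n G
    g = fromGraph G

  edges-unique : Unique (edges g)
  edges-unique = Uniqueₚ.filter⁺ (edge<? g) (allPairs-unique n)

  -- The equation `sorted` says that `es` gives every edge exactly one direction.
  module _ (es : Arcs n) (sorted : map sort es ≡ edges g) where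
    unique : Unique (map sort es)
    unique = subst Unique (≡.sym sorted) edges-unique

    ∈⇒edge : ∀ {u v} → (u , v) ∈ es → Adj G u v
    ∈⇒edge {u} {v} i with ∈-filter⁻ (edge<? g) {xs = allPairs n} (subst (sort (u , v) ∈_) sorted (∈-map⁺ sort i)) | sort-cases u v
    ... | _ , p | inj₁ q = proj₂ (subst (Edge< g) q p)
    ... | _ , p | inj₂ q = esym g (proj₂ (subst (Edge< g) q p))

    edge⇒∈ : ∀ {u v} → Adj G u v → (u , v) ∈ es ⊎ (v , u) ∈ es
    edge⇒∈ {u} {v} e = case ∈-map⁻ sort (subst (sort (u , v) ∈_) (≡.sym sorted)
        (∈-filter⁺ (edge<? g) (∈-allPairs _ _) below)) of λ
      { ((a , b) , i , q) → case sort-injective (≡.sym q) of λ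
        { (inj₁ (≡.refl , ≡.refl)) → inj₁ i ; (inj₂ (≡.refl , ≡.refl)) → inj₂ i } }
      where
      below : Edge< g (sort (u , v))
      below with Finₚ.<-cmp u v
      ... | tri< p _ _ = subst (Edge< g) (≡.sym (sort-< p)) (p , e)
      ... | tri≈ _ p _ = contradiction p (edge≢ g e)
      ... | tri> _ _ p = subst (Edge< g) (≡.sym (sort-> p)) (p , esym g e)

    not-both : ∀ {u v} → (u , v) ∈ es → ¬ (v , u) ∈ es
    not-both {u} {v} i j with ≡.refl ← distinct-images unique i j (sort-swap (edge≢ g (∈⇒edge i)))
      = edge≢ g (∈⇒edge i) ≡.refl

    open import Data.List.Membership.DecPropositional (≡-dec (_≟_ {n}) (_≟_ {n})) using (_∈?_)

    orientation : Orientation G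
    orientation = record
      { arc     = λ u v → does ((u , v) ∈? es)
      ; arc⇒adj = λ u v p → case (u , v) ∈? es of λ
          { (yes i) → ∈⇒edge i
          ; (no ¬i) → case ≡.trans (≡.sym p) (dec-false ((u , v) ∈? es) ¬i) of λ () }
      ; adj⇒one = λ u v e → case edge⇒∈ e of λ
          { (inj₁ i) → inj₁ (dec-true ((u , v) ∈? es) i , dec-false ((v , u) ∈? es) (not-both i))
          ; (inj₂ i) → inj₂ (dec-false ((u , v) ∈? es) (not-both i) , dec-true ((v , u) ∈? es) i) }
      }

    private D = orientation

    arc⇒∈ : ∀ {u v} → Orientation.arc D u v ≡ true → (u , v) ∈ es
    arc⇒∈ {u} {v} p = case (u , v) ∈? es of λ
      { (yes i) → i ; (no ¬i) → case ≡.trans (≡.sym p) (dec-false ((u , v) ∈? es) ¬i) of λ () }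

    isArc : Fin n × Fin n → Bool
    isArc e = Orientation.arc D (proj₁ e) (proj₂ e)

    arcs-unique : Unique (arcs D)
    arcs-unique = Uniqueₚ.filter⁺ (T? ∘ isArc) (allPairs-unique n)

    -- `diff` runs over `arcs D`, which has an order of its own; a permutation suffices, as the
    -- product of the edge factors and the out-degrees ignore order.
    arcs-↭ : arcs D ↭ es
    arcs-↭ = ↭-unique arcs-unique (Uniqueₚ.map⁻ unique)
      (λ i → arc⇒∈ (proj₂ (∈-filterᵇ⁻ isArc {as = allPairs n} i)))
      (λ {a} i → ∈-filterᵇ⁺ isArc {as = allPairs n} (∈-allPairs _ _) (dec-true (a ∈? es) i))

    outdeg-arcs : ∀ v → outdeg D v ≡ outdegIn (arcs D) v
    outdeg-arcs v = ≡.trans (≡.sym (length-map (v ,_) (filterᵇ (Orientation.arc D v) (allFin n))))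
      (↭-length (↭-unique (Uniqueₚ.map⁺ (λ { ≡.refl → ≡.refl }) (Uniqueₚ.filter⁺ (T? ∘ Orientation.arc D v) (Uniqueₚ.allFin⁺ n)))
        (Uniqueₚ.filter⁺ (T? ∘ λ e → eqF (proj₁ e) v) arcs-unique)
        (λ i → case ∈-map⁻ (v ,_) i of λ
          { (w , j , ≡.refl) → ∈-filterᵇ⁺ (λ e → eqF (proj₁ e) v) {as = arcs D}
              (∈-filterᵇ⁺ isArc {as = allPairs n} (∈-allPairs v w) (proj₂ (∈-filterᵇ⁻ (Orientation.arc D v) {as = allFin n} j)))
              (dec-true (v ≟ v) ≡.refl) })
        (λ {e} i → to e (∈-filterᵇ⁻ (λ e → eqF (proj₁ e) v) {as = arcs D} i))))
      where
      to : ∀ e → e ∈ arcs D × eqF (proj₁ e) v ≡ true → e ∈ map (v ,_) (filterᵇ (Orientation.arc D v) (allFin n))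
      to (u , w) (j , p) with ≡.refl ← eqF-true {u = u} {v} p =
        ∈-map⁺ (v ,_) (∈-filterᵇ⁺ (Orientation.arc D v) {as = allFin n} (∈-allFin w) (proj₂ (∈-filterᵇ⁻ isArc {as = allPairs n} j)))

    outdeg-es : ∀ v → outdeg D v ≡ outdegIn es v
    outdeg-es v = ≡.trans (outdeg-arcs v) (↭-length (filter-↭ (T? ∘ λ e → eqF (proj₁ e) v) arcs-↭))

    -- diff D has the parity of the number of Eulerian sub-digraphs, which is the coefficient of x^(outdeg D).
    diff-odd : coeff {n} (∏ {n} pair (edges g)) (outdegIn (arcs D)) ≡ true → Parity (diff D) true
    diff-odd p = subst (Parity (diff D)) odd
      (parity-sum _ isEulerian (λ S → parity-sign (isEulerian S) _) (subsets (arcs D)))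
      where
      open ≡.≡-Reasoning
      odd : parity {n} (map isEulerian (subsets (arcs D))) ≡ true
      odd = begin
        parity {n} (map isEulerian (subsets (arcs D)))
          ≡⟨ parity-cong {n} (All.universal (λ S → ≡.sym (balanced-eulerian S (arcs D))) (subsets (arcs D))) ⟩
        parity {n} (map (λ S → balanced S (arcs D) (outdegIn (arcs D))) (subsets (arcs D)))
          ≡⟨ ≡.sym (coeff-parity (arcs D) _ (coeff-bound {n} _ _ p)) ⟩
        coeff {n} (∏ {n} pair (arcs D)) (outdegIn (arcs D))
          ≡⟨ coeff-cong {n} _ (M.trans n (∏-↭ arcs-↭) (M.trans n (pair-sort es) (M.reflexive n (cong (∏ {n} pair) sorted)))) ⟩
        coeff {n} (∏ {n} pair (edges g)) (outdegIn (arcs D))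
          ≡⟨ p ⟩
        true ∎

  AT-orientation : ∀ m → coeff {n} (P g) m ≡ true → Σ (Orientation G) λ D → IsAT D × (∀ v → outdeg D v ≡ m v)
  AT-orientation m p =
    let q                   = ≡.trans (≡.sym (coeff-cong {n} m (P-edges g))) p
        (es , sorted , out) = orient-edges (edges g) m (All.map proj₁ (Allₚ.all-filter (edge<? g) (allPairs n))) q
        out′                = λ v → ≡.trans (outdeg-es es sorted v) (out v)
    in orientation es sorted
     , odd≢0 (diff-odd es sorted (≡.trans (coeff-ext {n} _ (λ v → ≡.trans (≡.sym (outdeg-arcs es sorted v)) (out′ v))) q))
     , out′

  -- A monomial of the product has exponents at most 2. Dividing it by x, y and z yields a monomial
  -- of `P g`, whose exponents become the out-degrees.
  extendable : ∀ x y z → Algebra₂.NZ n (M._*_ n (M._*_ n (var x) (M._*_ n (var y) (var z))) (P g)) → AT222Extendable G x y z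
  extendable x y z nz = case nonzero-coeff {n} (M._*_ n (var x) (M._*_ n (var y) (M._*_ n (var z) (P g)))) of λ
    { (inj₁ p) → contradiction (M.trans n (M.trans n (M.*-assoc n _ _ _) (M.*-congˡ n (M.*-assoc n _ _ _))) p) nz
    ; (inj₂ (m , p)) →
        let (_ , q) = coeff-var⁻ {n} x _ m p
            (_ , r) = coeff-var⁻ {n} y _ (lower x m) q
            (_ , s) = coeff-var⁻ {n} z _ (lower y (lower x m)) r
            (D , at , out) = AT-orientation _ s
        in D , at , λ v → subst (_≤ f222 G x y z v ∸ 1) (≡.sym (out v)) (bound m (coeff-bound {n} _ m p) v) }
    where
    below : ∀ v (m : Fin n → ℕ) → m v ≤ 2 → lower v m v ≤ 1
    below v m q = subst (_≤ 1) (≡.sym (lower-self v m)) (ℕₚ.pred-mono-≤ q)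

    bound : ∀ m → (∀ v → m v ≤ 2) → ∀ v → lower z (lower y (lower x m)) v ≤ f222 G x y z v ∸ 1
    bound m ≤2 v with eqF v x in p | eqF v y in q | eqF v z in r
    ... | true | _ | _ with ≡.refl ← eqF-true {u = v} {x} p =
      ≤-trans (lower-≤ z _ v) (≤-trans (lower-≤ y _ v) (below x m (≤2 x)))
    ... | false | true | _ with ≡.refl ← eqF-true {u = v} {y} q =
      ≤-trans (lower-≤ z _ v) (below y _ (≤-trans (lower-≤ x m v) (≤2 v)))
    ... | false | false | true with ≡.refl ← eqF-true {u = v} {z} r =
      below z _ (≤-trans (lower-≤ y _ v) (≤-trans (lower-≤ x m v) (≤2 v)))
    ... | false | false | false =
      ≤-trans (lower-≤ z _ v) (≤-trans (lower-≤ y _ v) (≤-trans (lower-≤ x m v) (≤2 v)))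

  -- Prepending hops to a homomorphism concatenates chains without arithmetic on their lengths.
  chain : ∀ {u v} → Diamonds g u v → ∀ {m} (φ : DiamondHom G m) → DiamondHom.uφ φ zero ≡ v →
          ∃ λ m′ → Σ (DiamondHom G m′) λ ψ → DiamondHom.uφ ψ zero ≡ u × (∀ {a} → InUImage φ a → InUImage ψ a)
  chain []                              φ p = _ , φ , p , id
  chain (hop {u} {a} {b} ua ub ab wa wb d) φ p with chain d φ p
  ... | m , ψ , ≡.refl , keep = suc m , record
      { uφ = λ { zero → u ; (suc i) → uφ i }
      ; vφ = λ { zero → a ; (suc i) → vφ i }
      ; wφ = λ { zero → b ; (suc i) → wφ i }
      ; e₁ = λ { zero → ua ; (suc i) → e₁ i }
      ; e₂ = λ { zero → ub ; (suc i) → e₂ i }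
      ; e₃ = λ { zero → ab ; (suc i) → e₃ i }
      ; e₄ = λ { zero → esym g wa ; (suc i) → e₄ i }
      ; e₅ = λ { zero → esym g wb ; (suc i) → e₅ i }
      } , ≡.refl , λ i → let (j , q) = keep i in suc j , q
    where open DiamondHom ψ

  monochromatic-connected : ∀ {x y z} → Monochromatic g x y z → ConnectedByDiamonds G x y z
  monochromatic-connected {x} {y} {z} (xy , yz) =
    -- The chain of length 0 is the single vertex `z`.
    let φ = record { uφ = λ _ → z ; vφ = λ () ; wφ = λ () ; e₁ = λ () ; e₂ = λ () ; e₃ = λ () ; e₄ = λ () ; e₅ = λ () }
        (_ , ψ , y₀ , keep)  = chain yz {0} φ ≡.refl
        (m , χ , x₀ , keep′) = chain xy ψ y₀
    in m , χ , (zero , x₀) , keep′ (zero , y₀) , keep′ (keep (zero , ≡.refl))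

-- The tips of a diamond avoid the two colours of its middle edge, which leaves one colour; all
-- cases are decided by evaluation.
third-colour : ∀ (i j k l : Fin 3) → i ≢ k → i ≢ l → k ≢ l → j ≢ k → j ≢ l → i ≡ j
third-colour = from-yes (all? λ (i : Fin 3) → all? λ (j : Fin 3) → all? λ (k : Fin 3) → all? λ (l : Fin 3) →
  ¬? (i ≟ k) →-dec (¬? (i ≟ l) →-dec (¬? (k ≟ l) →-dec (¬? (j ≟ k) →-dec (¬? (j ≟ l) →-dec (i ≟ j))))))

-- The first configuration is a chain of diamonds through the triple; in the second, any 3-colouring
-- gives the triple the three colours of a triangle.
infeasible-not-feasible : ∀ G {x y z} → Infeasible (fromGraph G) x y z → ¬ Feasible G x y z
infeasible-not-feasible G (inj₁ m) (¬c , _) = ¬c (monochromatic-connected G m)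
infeasible-not-feasible G (inj₂ (a , b , c , ab , bc , ac , xa , yb , zc)) (_ , col , proper , two) = case two of λ
    { (inj₁ p)        → proper a b ab (same xa yb p)
    ; (inj₂ (inj₁ p)) → proper b c bc (same yb zc p)
    ; (inj₂ (inj₂ p)) → proper a c ac (same xa zc p) }
  where
  colour : ∀ {u v} → Diamonds (fromGraph G) u v → col u ≡ col v
  colour []                    = ≡.refl
  colour (hop ua ub ab wa wb d) = ≡.trans (third-colour _ _ _ _ (proper _ _ ua) (proper _ _ ub) (proper _ _ ab)
                                           (proper _ _ wa) (proper _ _ wb)) (colour d)
  same : ∀ {u v u′ v′} → Diamonds (fromGraph G) u u′ → Diamonds (fromGraph G) v v′ → col u ≡ col v → col u′ ≡ col v′
  same d e p = ≡.trans (≡.sym (colour d)) (≡.trans p (colour e))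

theorem2 : (G : Graph) → K4MinorFree G → (x y z : V G) →
    x ≢ y → y ≢ z → x ≢ z →
    Feasible G x y z → AT222Extendable G x y z
theorem2 G free x y z _ _ _ feasible =
  case dichotomy (fromGraph G) (≺-wellFounded _) (fromGraph-free G free) x y z of λ
    { (inj₁ nz) → extendable G x y z nz
    ; (inj₂ i)  → contradiction feasible (infeasible-not-feasible G i) }
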